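{- Let $G$ be a finite connected graph, let $t>0$, and let $X$ be an optimal function for $G$ (with respect to $t$). If $u\in V(G)$ satisfies $X(u)<\mathbb{E}(X)$, then $$\nu_X-\big(X(u)-\mathbb{E}(X)\big)=d(u,\mathbb{O}(X)).$$ In particular, if $X$ is normalized so that $\mathbb{E}(X)=0$ and $X(u)<0$, then $\nu_X-X(u)=d(u,\mathbb{O}(X))$.
   Context: A function $X:V(G)\to\mathbb{R}$ is Lipschitz if $|X(u)-X(v)|\le d(u,v)$ for all $u,v$, where $d$ is the graph distance; it is treated as a random variable by placing the uniform distribution on $V(G)$. The log-moment function of $X$ is $L_X(t)=\ln \mathbb{E}\big(e^{t(X-\mathbb{E}X)}\big)$, and $L_G(t)=\max_X L_X(t)$, the maximum being over Lipschitz functions $X$ on $V(G)$. For fixed $t>0$, a Lipschitz function $X$ is optimal if $L_X(t)=L_G(t)$. $\mathbb{O}(X)=\{v\in V(G): -0.5<X(v)-\mathbb{E}(X)\le 0.5\}$, and $\nu_X=X(w)-\mathbb{E}(X)$ for a vertex $w\in\mathbb{O}(X)$. $d(u,\mathbb{O}(X))$ is the graph distance from $u$ to the set $\mathbb{O}(X)$. -}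

module Defs where

open import Level using (Level; _⊔_; 0ℓ) renaming (suc to lsuc)
open import Algebra.Apartness.Bundles using (HeytingField; HeytingCommutativeRing)
open import Algebra.Bundles using (CommutativeRing; Semiring)
import Algebra.Apartness.Properties.HeytingCommutativeRing as HeytingProperties
import Algebra.Definitions.RawSemiring as RawSemiringDefinitions
import Algebra.Properties.Ring as RingProperties
open import Data.Fin.Base using (Fin; zero; suc)
import Data.Fin.Properties as Fin
open import Data.Nat.Base as ℕ using (ℕ; zero; suc; NonZero; z≤n; s≤s; _!)
import Data.Nat.Properties as ℕ
open import Data.Product.Base using (∃; ∃-syntax; _×_; _,_; proj₁; proj₂)
open import Data.Sum.Base using (_⊎_; inj₁; inj₂)
open import Relation.Binary.Core using (Rel)
open import Relation.Binary.Definitions using (Decidable; Symmetric)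
open import Relation.Binary.PropositionalEquality.Core using (_≡_; refl)
open import Relation.Binary.Structures using (IsStrictPartialOrder)
open import Relation.Nullary.Decidable using (Dec; yes; no; map′; _×-dec_)
open import Relation.Nullary.Negation using (¬_; contradiction)
open import Relation.Unary using (Pred)
import Relation.Unary as U

private
  variable
    a p : Level

-- The real numbers: a Cauchy-complete Archimedean ordered field.  These axioms
-- determine ℝ up to isomorphism.  They are given in their constructive form
-- (an apartness induced by the order, _≤_ as the negation of _>_, and moduli
-- of convergence); classically this is the usual complete ordered field.

record RealField c ℓ₁ ℓ₂ : Set (lsuc (c ⊔ ℓ₁ ⊔ ℓ₂)) where
  field
    heytingField : HeytingField c ℓ₁ ℓ₂

  open HeytingField heytingField public renaming (zero to *-zero)

  infix 4 _<_ _≤_ ∣_∣≤_ _⟶_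

  field
    _<_                  : Rel Carrier ℓ₂
    isStrictPartialOrder : IsStrictPartialOrder _≈_ _<_
    #⇒<⊎>                : ∀ {x y} → x # y → x < y ⊎ y < x
    <⇒#                  : ∀ {x y} → x < y → x # y
    +-monoˡ-<            : ∀ {x y} z → x < y → x + z < y + z
    *-pos                : ∀ {x y} → 0# < x → 0# < y → 0# < x * y

  commutativeRing : CommutativeRing c ℓ₁
  commutativeRing = HeytingCommutativeRing.commutativeRing heytingCommutativeRing

  open RawSemiringDefinitions
    (Semiring.rawSemiring (CommutativeRing.semiring commutativeRing)) public
    using (_^_; sum) renaming (_×_ to _·_)

  fromℕ : ℕ → Carrier
  fromℕ n = n · 1#

  _≤_ : Rel Carrier ℓ₂
  x ≤ y = ¬ (y < x)

  ∣_∣≤_ : Rel Carrier ℓ₂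
  ∣ x ∣≤ y = x ≤ y × - x ≤ y

  _⟶_ : (ℕ → Carrier) → Carrier → Set (c ⊔ ℓ₂)
  s ⟶ l = ∀ ε → 0# < ε → ∃[ N ] (∀ n → N ℕ.≤ n → ∣ s n - l ∣≤ ε)

  Cauchy : (ℕ → Carrier) → Set (c ⊔ ℓ₂)
  Cauchy s = ∀ ε → 0# < ε →
    ∃[ N ] (∀ m n → N ℕ.≤ m → N ℕ.≤ n → ∣ s m - s n ∣≤ ε)

  field
    archimedean : ∀ x → ∃[ n ] x < fromℕ n
    complete    : ∀ s → Cauchy s → ∃[ l ] s ⟶ l

  module < = IsStrictPartialOrder isStrictPartialOrder

  +-monoʳ-< : ∀ z {x y} → x < y → z + x < z + y
  +-monoʳ-< z {x} {y} x<y =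
    <.<-respʳ-≈ (+-comm y z) (<.<-respˡ-≈ (+-comm x z) (+-monoˡ-< z x<y))

  +-pos : ∀ {x y} → 0# < x → 0# < y → 0# < x + y
  +-pos {x} {y} 0<x 0<y =
    <.trans 0<x (<.<-respˡ-≈ (+-identityʳ x) (+-monoʳ-< x 0<y))

  0<1 : 0# < 1#
  0<1 with #⇒<⊎> (HeytingProperties.1#0 heytingCommutativeRing)
  ... | inj₂ 0<1 = 0<1
  ... | inj₁ 1<0 = <.<-respʳ-≈ [-1]*[-1]≈1 (*-pos 0<-1 0<-1)
    where
    open RingProperties (CommutativeRing.ring commutativeRing)
      using (-1*x≈-x; -‿involutive)
    0<-1 : 0# < - 1#
    0<-1 = <.<-respˡ-≈ (-‿inverseʳ 1#)
             (<.<-respʳ-≈ (+-identityˡ (- 1#)) (+-monoˡ-< (- 1#) 1<0))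
    [-1]*[-1]≈1 : - 1# * - 1# ≈ 1#
    [-1]*[-1]≈1 = trans (-1*x≈-x (- 1#)) (-‿involutive 1#)

  fromℕ-pos : ∀ {n} → 0 ℕ.< n → 0# < fromℕ n
  fromℕ-pos {suc zero}    _ = <.<-respʳ-≈ (sym (+-identityʳ 1#)) 0<1
  fromℕ-pos {suc (suc n)} _ = +-pos 0<1 (fromℕ-pos {suc n} (s≤s z≤n))

  private
    fromℕ#0 : ∀ n → .{{NonZero n}} → fromℕ n # 0#
    fromℕ#0 n = #-sym (<⇒# (fromℕ-pos (ℕ.>-nonZero⁻¹ n)))

  infix 8 1/_
  1/_ : (n : ℕ) → .{{NonZero n}} → Carrier
  1/ n = proj₁ (#⇒invertible (fromℕ#0 n))

  1/-inverseˡ : ∀ n → .{{_ : NonZero n}} → 1/ n * fromℕ n ≈ 1#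
  1/-inverseˡ n = trans (*-congˡ (sym (HeytingProperties.x-0≈x heytingCommutativeRing (fromℕ n))))
                        (proj₁ (proj₂ (#⇒invertible (fromℕ#0 n))))

  1/-pos : ∀ n → .{{_ : NonZero n}} → 0# < 1/ n
  1/-pos n with #⇒<⊎> 1/n#0
    where
    1/n#0 : 1/ n # 0#
    1/n#0 = HeytingProperties.invertibleʳ⇒# heytingCommutativeRing
      (fromℕ n , trans (*-congʳ (HeytingProperties.x-0≈x heytingCommutativeRing (1/ n)))
                       (1/-inverseˡ n))
  ... | inj₂ 0<1/n = 0<1/n
  ... | inj₁ 1/n<0 = contradiction 0<-1 (λ 0<-1 → <.asym 0<1 (-1<0⇒ 0<-1))
    where
    open RingProperties (CommutativeRing.ring commutativeRing) using (-‿distribˡ-*)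
    0<-1/n : 0# < - 1/ n
    0<-1/n = <.<-respˡ-≈ (-‿inverseʳ (1/ n))
               (<.<-respʳ-≈ (+-identityˡ (- 1/ n)) (+-monoˡ-< (- 1/ n) 1/n<0))
    0<-1 : 0# < - 1#
    0<-1 = <.<-respʳ-≈
      (trans (sym (-‿distribˡ-* (1/ n) (fromℕ n))) (-‿cong (1/-inverseˡ n)))
      (*-pos 0<-1/n (fromℕ-pos (ℕ.>-nonZero⁻¹ n)))
    -1<0⇒ : 0# < - 1# → 1# < 0#
    -1<0⇒ h = <.<-respʳ-≈ (-‿inverseʳ 1#)
                (<.<-respˡ-≈ (+-identityʳ 1#) (+-monoʳ-< 1# h))

  sum-pos : ∀ {n} → .{{NonZero n}} → (f : Fin n → Carrier) →
            (∀ i → 0# < f i) → 0# < sum f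
  sum-pos {suc zero}    f 0<f = <.<-respʳ-≈ (sym (+-identityʳ (f zero))) (0<f zero)
  sum-pos {suc (suc n)} f 0<f =
    +-pos (0<f zero) (sum-pos {suc n} (λ i → f (suc i)) (λ i → 0<f (suc i)))

  expSeries : Carrier → ℕ → Carrier
  expSeries x zero    = 0#
  expSeries x (suc n) = expSeries x n + x ^ n * (1/ (n !)) {{ℕ._!≢0 n}}

-- exp is determined by its power series and ln as the inverse of exp on the
-- positive reals.  exp-pos is a consequence of exp-series, recorded so that ln
-- can be applied to averages of exponentials; ln takes a proof of positivity
-- because constructively it does not extend to a function on all of ℝ.

record ExpLn {c ℓ₁ ℓ₂} (ℝ : RealField c ℓ₁ ℓ₂) : Set (c ⊔ ℓ₁ ⊔ ℓ₂) where
  open RealField ℝ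
  field
    exp        : Carrier → Carrier
    exp-series : ∀ x → expSeries x ⟶ exp x
    exp-pos    : ∀ x → 0# < exp x
    ln         : ∀ y → 0# < y → Carrier
    exp-ln     : ∀ y (0<y : 0# < y) → exp (ln y 0<y) ≈ y

least : {P : Pred ℕ p} → U.Decidable P → ∃ P →
        ∃[ m ] P m × (∀ j → P j → m ℕ.≤ j)
least {P = P} P? (k , Pk) = go k 0 (λ _ _ → z≤n) (ℕ.+-identityʳ k)
  where
  go : ∀ fuel m → (∀ j → P j → m ℕ.≤ j) → fuel ℕ.+ m ≡ k →
       ∃[ m ] P m × (∀ j → P j → m ℕ.≤ j)
  go fuel m m≤ eq with P? m
  ... | yes Pm = m , Pm , m≤
  go zero m m≤ refl | no ¬Pm = contradiction Pk ¬Pm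
  go (suc fuel) m m≤ refl | no ¬Pm =
    go fuel (suc m) (λ j Pj → ℕ.≤∧≢⇒< (m≤ j Pj) λ { refl → ¬Pm Pj }) (ℕ.+-suc fuel m)

data Walk {V : Set a} (_~_ : Rel V 0ℓ) : V → V → ℕ → Set a where
  []  : ∀ {u} → Walk _~_ u u 0
  _∷_ : ∀ {u v w k} → u ~ v → Walk _~_ v w k → Walk _~_ u w (suc k)

record FiniteConnectedGraph : Set₁ where
  field
    order         : ℕ
    {{order≢0}}   : NonZero order

  Vertex : Set
  Vertex = Fin order

  field
    _~_       : Rel Vertex 0ℓ
    _~?_      : Decidable _~_
    ~-sym     : Symmetric _~_
    ~-irrefl  : ∀ {u} → ¬ (u ~ u)
    connected : ∀ u v → ∃[ k ] Walk _~_ u v k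

  walk? : ∀ u v k → Dec (Walk _~_ u v k)
  walk? u v zero    = map′ (λ { refl → [] }) (λ { [] → refl }) (u Fin.≟ v)
  walk? u v (suc k) = map′ (λ { (_ , e , w) → e ∷ w }) (λ { (e ∷ w) → _ , e , w })
    (Fin.any? (λ x → (u ~? x) ×-dec walk? x v k))

  shortest : ∀ u v → ∃[ k ] Walk _~_ u v k × (∀ j → Walk _~_ u v j → k ℕ.≤ j)
  shortest u v = least (walk? u v) (connected u v)

  dist : Vertex → Vertex → ℕ
  dist u v = proj₁ (shortest u v)

  -- Distance to a set, as an attained minimum: membership in S need not be
  -- decidable, so there is no function computing it.
  infix 4 dist[_,_]≡_
  dist[_,_]≡_ : Vertex → Pred Vertex p → ℕ → Set p
  dist[ u , S ]≡ k = (∃[ w ] S w × dist u w ≡ k) × (∀ w → S w → k ℕ.≤ dist u w)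

module LogMoments {c ℓ₁ ℓ₂} (ℝ : RealField c ℓ₁ ℓ₂) (expLn : ExpLn ℝ)
                  (G : FiniteConnectedGraph) where
  open RealField ℝ
  open ExpLn expLn
  open FiniteConnectedGraph G

  RandomVariable : Set c
  RandomVariable = Vertex → Carrier

  𝔼 : RandomVariable → Carrier
  𝔼 X = 1/ order * sum X

  Lipschitz : RandomVariable → Set ℓ₂
  Lipschitz X = ∀ u v → ∣ X u - X v ∣≤ fromℕ (dist u v)

  moment : RandomVariable → Carrier → Carrier
  moment X t = 𝔼 (λ v → exp (t * (X v - 𝔼 X)))

  moment-pos : ∀ X t → 0# < moment X t
  moment-pos X t = *-pos (1/-pos order) (sum-pos _ (λ v → exp-pos (t * (X v - 𝔼 X))))

  L[_] : RandomVariable → Carrier → Carrier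
  L[ X ] t = ln (moment X t) (moment-pos X t)

  -- ℓ = L_G(t), the maximum of L_X(t) over Lipschitz X.
  IsL[G] : Carrier → Carrier → Set (c ⊔ ℓ₁ ⊔ ℓ₂)
  IsL[G] t ℓ = (∃[ X ] Lipschitz X × L[ X ] t ≈ ℓ)
             × (∀ X → Lipschitz X → L[ X ] t ≤ ℓ)

  Optimal : Carrier → RandomVariable → Set (c ⊔ ℓ₁ ⊔ ℓ₂)
  Optimal t X = Lipschitz X × IsL[G] t (L[ X ] t)

  𝕆 : RandomVariable → Pred Vertex ℓ₂
  𝕆 X v = - 1/ 2 < X v - 𝔼 X × X v - 𝔼 X ≤ 1/ 2

  -- A relation, since ν_X is read off at an arbitrary vertex of 𝕆 X.
  Isν : RandomVariable → Carrier → Set (ℓ₁ ⊔ ℓ₂)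
  Isν X ν = ∃[ w ] 𝕆 X w × ν ≈ X w - 𝔼 X

{-# OPTIONS --safe #-}

-- Let e v = exp (t (X v - 𝔼 X)).  Since 1 + h ≤ exp h with equality only at
-- h = 0, optimality gives s · Σ e v (D v - 𝔼 D) ≤ 0 whenever X + s D is
-- Lipschitz, and X ± D cannot both be Lipschitz unless D is constant.
--
-- Applied to the indicator of a class of vertices on which X agrees modulo ℤ,
-- the second fact shows that X has integral differences.  Applied to a single
-- vertex u with X u < 𝔼 X, where e u < 1 ≤ 𝔼 e, the first shows that X cannot
-- be lowered at u, so that X v - X u = d (u , v) for some v ≠ u and X rises by 1
-- on the first edge of a geodesic from u to v.  Iterating, X climbs from u to
-- 𝕆 X in steps of 1, along a path that is a geodesic because X is Lipschitz.
--
-- Order and equality on ℝ are undecidable, but _≤_ and _≈_ are ¬¬-stable, so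
-- these arguments may be classical.  Once differences of X are known to be
-- integers, X v - 𝔼 X is rational with denominator the order of G; hence 𝕆 X
-- is decidable and the climb is an actual construction.

module Submission where

open import Defs
open import Algebra.Bundles using (CommutativeRing)
import Algebra.Properties.Ring as RingProperties
import Algebra.Properties.Semiring.Mult as Mult
import Algebra.Properties.Semiring.Mult.TCOptimised as Mult′
import Algebra.Properties.Semiring.Sum as Sum
import Algebra.Solver.Ring as RingSolver
open import Algebra.Solver.Ring.AlmostCommutativeRing
  using (fromCommutativeRing; _-Raw-AlmostCommutative⟶_)
open import Data.Bool.Base using (if_then_else_)
open import Data.Empty using (⊥)
open import Data.Fin.Base as Fin using (Fin; zero; suc)
import Data.Fin.Properties as Fin
open import Data.Integer.Base as ℤ using (ℤ; +_; -[1+_])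
import Data.Integer.Properties as ℤ
import Data.Maybe.Base as Maybe
open import Data.Nat.Base as ℕ using (ℕ; zero; suc; z≤n; s≤s; _!; _∸_)
import Data.Nat.Properties as ℕ
open import Data.Product.Base using (∃-syntax; _×_; _,_; proj₁; proj₂)
import Data.Sign.Base as Sign
open import Data.Sum.Base using (_⊎_; inj₁; inj₂)
open import Function.Base using (_∘_; _$_)
open import Level using (_⊔_)
open import Relation.Binary.PropositionalEquality.Core as ≡ using (_≡_; _≢_)
import Relation.Binary.Reasoning.Setoid as ≈-Reasoning
open import Relation.Nullary.Decidable
  using (Dec; yes; no; does; map′; dec⇒maybe; _×-dec_; ¬?; ¬¬-excluded-middle; decidable-stable)
open import Relation.Nullary.Negation using (¬_; contradiction)

-- Integer multiples of one, and the ring solver.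

module IntegerMultiples {c ℓ} (R : CommutativeRing c ℓ) where
  open CommutativeRing R
  open RingProperties ring
  -- With this variant `1 · 1#` computes to `1#`, so `con (+ 1)` and `con (+ 2)` mean `1#` and
  -- `1# + 1#`. Numerals built by `fromℕ` end in `+ 0#`, which is why some solver equations spell
  -- out `con (+ 1) :+ con (+ 0)`.
  open Mult′ semiring using (1+×; ×-homo-+; ×1-homo-*) renaming (_×_ to _·_)
  open ≈-Reasoning setoid

  fromℤ : ℤ → Carrier
  fromℤ (+ n)    = n · 1#
  fromℤ -[1+ n ] = - (suc n · 1#)

  private
    cancelˡ : ∀ x y z → (x + y) - (x + z) ≈ y - z
    cancelˡ x y z = begin
      (x + y) - (x + z)        ≈⟨ +-cong (+-comm x y) (sym (-‿+-comm x z)) ⟩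
      (y + x) + (- x + - z)    ≈⟨ +-assoc y x _ ⟩
      y + (x + (- x + - z))    ≈⟨ +-congˡ (+-assoc x (- x) (- z)) ⟨
      y + ((x - x) + - z)      ≈⟨ +-congˡ (+-congʳ (-‿inverseʳ x)) ⟩
      y + (0# + - z)           ≈⟨ +-congˡ (+-identityˡ (- z)) ⟩
      y - z                    ∎

  fromℤ-⊖ : ∀ m n → fromℤ (m ℤ.⊖ n) ≈ m · 1# - n · 1#
  fromℤ-⊖ m       zero    = sym (trans (+-congˡ -0#≈0#) (+-identityʳ _))
  fromℤ-⊖ zero    (suc n) = sym (+-identityˡ _)
  fromℤ-⊖ (suc m) (suc n) = begin
    fromℤ (suc m ℤ.⊖ suc n)            ≡⟨ ≡.cong fromℤ (ℤ.[1+m]⊖[1+n]≡m⊖n m n) ⟩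
    fromℤ (m ℤ.⊖ n)                    ≈⟨ fromℤ-⊖ m n ⟩
    m · 1# - n · 1#                    ≈⟨ cancelˡ 1# _ _ ⟨
    (1# + m · 1#) - (1# + n · 1#)      ≈⟨ +-cong (1+× m 1#) (-‿cong (1+× n 1#)) ⟨
    suc m · 1# - suc n · 1#            ∎

  fromℤ-+ : ∀ i j → fromℤ (i ℤ.+ j) ≈ fromℤ i + fromℤ j
  fromℤ-+ (+ m)    (+ n)    = ×-homo-+ 1# m n
  fromℤ-+ (+ m)    -[1+ n ] = fromℤ-⊖ m (suc n)
  fromℤ-+ -[1+ m ] (+ n)    = trans (fromℤ-⊖ n (suc m)) (+-comm _ _)
  fromℤ-+ -[1+ m ] -[1+ n ] = begin
    - (suc (suc (m ℕ.+ n)) · 1#)       ≡⟨ ≡.cong (λ k → - (k · 1#))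
      (≡.sym (ℕ.+-suc (suc m) n)) ⟩
    - ((suc m ℕ.+ suc n) · 1#)         ≈⟨ -‿cong (×-homo-+ 1# (suc m) (suc n)) ⟩
    - (suc m · 1# + suc n · 1#)        ≈⟨ -‿+-comm _ _ ⟨
    - (suc m · 1#) - suc n · 1#        ∎

  fromℤ-neg : ∀ i → fromℤ (ℤ.- i) ≈ - fromℤ i
  fromℤ-neg (+ zero)  = sym -0#≈0#
  fromℤ-neg (+ suc n) = refl
  fromℤ-neg -[1+ n ]  = sym (-‿involutive _)

  private
    fromℤ-◃- : ∀ n → fromℤ (Sign.- ℤ.◃ n) ≈ - (n · 1#)
    fromℤ-◃- zero    = sym -0#≈0#
    fromℤ-◃- (suc n) = refl

    fromℤ-◃+ : ∀ n → fromℤ (Sign.+ ℤ.◃ n) ≈ n · 1#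
    fromℤ-◃+ zero    = refl
    fromℤ-◃+ (suc n) = refl

  fromℤ-* : ∀ i j → fromℤ (i ℤ.* j) ≈ fromℤ i * fromℤ j
  fromℤ-* (+ m)    (+ n)    = trans (fromℤ-◃+ (m ℕ.* n)) (×1-homo-* m n)
  fromℤ-* (+ m)    -[1+ n ] = trans (fromℤ-◃- (m ℕ.* suc n))
    (trans (-‿cong (×1-homo-* m (suc n))) (-‿distribʳ-* _ _))
  fromℤ-* -[1+ m ] (+ n)    = trans (fromℤ-◃- (suc m ℕ.* n))
    (trans (-‿cong (×1-homo-* (suc m) n)) (-‿distribˡ-* _ _))
  fromℤ-* -[1+ m ] -[1+ n ] = begin
    fromℤ (Sign.+ ℤ.◃ (suc m ℕ.* suc n))   ≈⟨ fromℤ-◃+ (suc m ℕ.* suc n) ⟩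
    (suc m ℕ.* suc n) · 1#                 ≈⟨ ×1-homo-* (suc m) (suc n) ⟩
    (suc m · 1#) * (suc n · 1#)            ≈⟨ -‿involutive _ ⟨
    - - ((suc m · 1#) * (suc n · 1#))      ≈⟨ -‿cong (-‿distribʳ-* _ _) ⟩
    - ((suc m · 1#) * - (suc n · 1#))      ≈⟨ -‿distribˡ-* _ _ ⟩
    - (suc m · 1#) * - (suc n · 1#)        ∎

  fromℤ-morphism : ℤ.+-*-rawRing -Raw-AlmostCommutative⟶ fromCommutativeRing R
  fromℤ-morphism = record
    { ⟦_⟧    = fromℤ
    ; +-homo = fromℤ-+
    ; *-homo = fromℤ-*
    ; -‿homo = fromℤ-neg
    ; 0-homo = refl
    ; 1-homo = refl
    }

  -- Coefficients are integers because their equality is decidable, unlike equality of reals; this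
  -- lets numerals cancel.
  module Solver = RingSolver ℤ.+-*-rawRing (fromCommutativeRing R) fromℤ-morphism
    (λ i j → Maybe.map (reflexive ∘ ≡.cong fromℤ) (dec⇒maybe (i ℤ.≟ j)))

-- Order and bounds in a constructive real field.

module Order {c ℓ₁ ℓ₂} (ℝ : RealField c ℓ₁ ℓ₂) where
  open RealField ℝ
  open IntegerMultiples commutativeRing public
  open Solver public using (solve; _:+_; _:*_; _:-_; :-_; _:=_; con)
  module Ring = CommutativeRing commutativeRing
  open RingProperties Ring.ring public using (-‿involutive; -1*x≈-x)

  private variable x y z w : Carrier

  -- A substitute for trichotomy: `x # y` splits at `z`, and if the apartness returned points the
  -- wrong way, transitivity still gives one of the two alternatives.
  <-cotrans : x < y → ∀ z → x < z ⊎ z < y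
  <-cotrans x<y z with #-cotrans (<⇒# x<y) z
  ... | inj₁ x#z with #⇒<⊎> x#z
  ...   | inj₁ x<z = inj₁ x<z
  ...   | inj₂ z<x = inj₂ (<.trans z<x x<y)
  <-cotrans x<y z | inj₂ z#y with #⇒<⊎> z#y
  ...   | inj₁ z<y = inj₂ z<y
  ...   | inj₂ y<z = inj₁ (<.trans x<y y<z)

  ≤-antisym : x ≤ y → y ≤ x → x ≈ y
  ≤-antisym {x} {y} x≤y y≤x = proj₁ (tight x y) λ x#y → case (#⇒<⊎> x#y)
    where
    case : x < y ⊎ y < x → ⊥
    case (inj₁ x<y) = y≤x x<y
    case (inj₂ y<x) = x≤y y<x

  <⇒≤ : x < y → x ≤ y
  <⇒≤ x<y y<x = <.asym x<y y<x

  ≈⇒≤ : x ≈ y → x ≤ y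
  ≈⇒≤ x≈y = <.irrefl (sym x≈y)

  ≤-refl : x ≤ x
  ≤-refl = ≈⇒≤ refl

  <-≤-trans : x < y → y ≤ z → x < z
  <-≤-trans {z = z} x<y y≤z with <-cotrans x<y z
  ... | inj₁ x<z = x<z
  ... | inj₂ z<y = contradiction z<y y≤z

  ≤-<-trans : x ≤ y → y < z → x < z
  ≤-<-trans {x = x} x≤y y<z with <-cotrans y<z x
  ... | inj₁ y<x = contradiction y<x x≤y
  ... | inj₂ x<z = x<z

  ≤-trans : x ≤ y → y ≤ z → x ≤ z
  ≤-trans x≤y y≤z z<x = x≤y (≤-<-trans y≤z z<x)

  ≈-stable : ¬ ¬ (x ≈ y) → x ≈ y
  ≈-stable ¬¬x≈y = ≤-antisym (λ y<x → ¬¬x≈y λ x≈y → ≈⇒≤ x≈y y<x)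
                             (λ x<y → ¬¬x≈y λ x≈y → ≈⇒≤ (sym x≈y) x<y)

  ≤-resp : x ≈ y → z ≈ w → x ≤ z → y ≤ w
  ≤-resp x≈y z≈w x≤z = ≤-trans (≈⇒≤ (sym x≈y)) (≤-trans x≤z (≈⇒≤ z≈w))

  -- Provides classical case splits when the goal is `⊥`. A proof of `_≤_` has that goal once the
  -- reverse strict inequality is assumed.
  ≤-⊎-> : ∀ x y → ¬ ¬ (x ≤ y ⊎ y < x)
  ≤-⊎-> x y k = k (inj₁ λ y<x → k (inj₂ y<x))

  <-⊎-≈ : x ≤ y → ¬ ¬ (x < y ⊎ x ≈ y)
  <-⊎-≈ {x} {y} x≤y k = k (inj₂ (≤-antisym x≤y λ x<y → k (inj₁ x<y)))

  -- Inequalities are proved by exhibiting the difference of their two sides as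
  -- a nonnegative (positive) expression; the ring solver checks the rest.

  <-by : 0# < z → z ≈ y - x → x < y
  <-by {z} {y} {x} 0<z z≈y-x =
    <.<-respˡ-≈ (+-identityˡ x) $
    <.<-respʳ-≈ (trans (+-congʳ z≈y-x) (solve 2 (λ x y → y :- x :+ x := y) refl x y)) $
    +-monoˡ-< x 0<z

  <⇒0< : x < y → 0# < y - x
  <⇒0< {x} x<y = <.<-respˡ-≈ (-‿inverseʳ x) (+-monoˡ-< (- x) x<y)

  ≤-by : 0# ≤ z → z ≈ y - x → x ≤ y
  ≤-by {z} {y} {x} 0≤z z≈y-x y<x =
    0≤z (<-by (<⇒0< y<x)
      (trans (solve 2 (λ x y → x :- y := con (+ 0) :- (y :- x)) refl x y)
             (+-congˡ (-‿cong (sym z≈y-x)))))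

  ≤⇒0≤ : x ≤ y → 0# ≤ y - x
  ≤⇒0≤ {x} {y} x≤y y-x<0 = x≤y (<-by (<⇒0< y-x<0)
    (solve 2 (λ x y → con (+ 0) :- (y :- x) := x :- y) refl x y))

  +-nonneg : 0# ≤ x → 0# ≤ y → 0# ≤ x + y
  +-nonneg {x} {y} 0≤x 0≤y = ≤-trans 0≤x
    (≤-by 0≤y (solve 2 (λ x y → y := (x :+ y) :- x) refl x y))

  +-mono-≤ : x ≤ y → z ≤ w → x + z ≤ y + w
  +-mono-≤ {x} {y} {z} {w} x≤y z≤w = ≤-by (+-nonneg (≤⇒0≤ x≤y) (≤⇒0≤ z≤w))
    (solve 4 (λ x y z w → (y :- x) :+ (w :- z) := (y :+ w) :- (x :+ z)) refl x y z w)

  *-nonneg : 0# ≤ x → 0# ≤ y → 0# ≤ x * y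
  *-nonneg {x} {y} 0≤x 0≤y xy<0 = <-⊎-≈ 0≤x λ where
    (inj₂ 0≈x) → ≈⇒≤ (trans (sym (zeroˡ y)) (*-congʳ 0≈x)) xy<0
    (inj₁ 0<x) → <-⊎-≈ 0≤y λ where
      (inj₂ 0≈y) → ≈⇒≤ (trans (sym (zeroʳ x)) (*-congˡ 0≈y)) xy<0
      (inj₁ 0<y) → <.asym xy<0 (*-pos 0<x 0<y)

  *-monoˡ-≤ : 0# ≤ z → x ≤ y → z * x ≤ z * y
  *-monoˡ-≤ {z} {x} {y} 0≤z x≤y = ≤-by (*-nonneg 0≤z (≤⇒0≤ x≤y))
    (solve 3 (λ x y z → z :* (y :- x) := z :* y :- z :* x) refl x y z)

  *-cancelˡ-≤ : 0# < z → z * x ≤ z * y → x ≤ y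
  *-cancelˡ-≤ {z} {x} {y} 0<z zx≤zy y<x = zx≤zy (<-by (*-pos 0<z (<⇒0< y<x))
    (solve 3 (λ x y z → z :* (x :- y) := z :* x :- z :* y) refl x y z))

  *-cancelˡ-≈ : 0# < z → z * x ≈ z * y → x ≈ y
  *-cancelˡ-≈ 0<z zx≈zy = ≤-antisym (*-cancelˡ-≤ 0<z (≈⇒≤ zx≈zy))
    (*-cancelˡ-≤ 0<z (≈⇒≤ (sym zx≈zy)))

  square≤0⇒≈0 : x * x ≤ 0# → x ≈ 0#
  square≤0⇒≈0 {x} xx≤0 = ≤-antisym
    (λ 0<x → xx≤0 (*-pos 0<x 0<x))
    (λ x<0 → xx≤0 (<.<-respʳ-≈ (solve 1 (λ x → (con (+ 0) :- x) :* (con (+ 0) :- x) := x :* x)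
      refl x)
      (*-pos (<⇒0< x<0) (<⇒0< x<0))))

  0≤1 : 0# ≤ 1#
  0≤1 = <⇒≤ 0<1

  fromℕ≈fromℤ : ∀ n → fromℕ n ≈ fromℤ (+ n)
  fromℕ≈fromℤ n = Mult′.×ᵤ≈× Ring.semiring n 1#

  fromℕ-nonneg : ∀ n → 0# ≤ fromℕ n
  fromℕ-nonneg zero    = ≤-refl
  fromℕ-nonneg (suc n) = +-nonneg 0≤1 (fromℕ-nonneg n)

  fromℕ-+ : ∀ m n → fromℕ (m ℕ.+ n) ≈ fromℕ m + fromℕ n
  fromℕ-+ m n = Mult.×-homo-+ Ring.semiring 1# m n

  fromℕ-mono-≤ : ∀ {m n} → m ℕ.≤ n → fromℕ m ≤ fromℕ n
  fromℕ-mono-≤ {n = n} z≤n = fromℕ-nonneg n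
  fromℕ-mono-≤ (s≤s m≤n) = +-mono-≤ ≤-refl (fromℕ-mono-≤ m≤n)

  fromℕ-mono-< : ∀ {m n} → m ℕ.< n → fromℕ m < fromℕ n
  fromℕ-mono-< {m} m<n = <-≤-trans (<-by 0<1
    (solve 1 (λ a → con (+ 1) := con (+ 1) :+ a :- a) refl (fromℕ m))) (fromℕ-mono-≤ m<n)

  fromℕ-cancel-≤ : ∀ {m n} → fromℕ m ≤ fromℕ n → m ℕ.≤ n
  fromℕ-cancel-≤ m≤n = ℕ.≮⇒≥ λ n<m → m≤n (fromℕ-mono-< n<m)

  ∣∣-+ : ∣ x ∣≤ z → ∣ y ∣≤ w → ∣ x + y ∣≤ z + w
  ∣∣-+ {x} {z} {y} {w} (x≤z , -x≤z) (y≤w , -y≤w) = +-mono-≤ x≤z y≤w ,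
    ≤-resp (solve 2 (λ x y → :- x :+ :- y := :- (x :+ y)) refl x y) refl (+-mono-≤ -x≤z -y≤w)

  ∣∣-resp : x ≈ y → z ≈ w → ∣ x ∣≤ z → ∣ y ∣≤ w
  ∣∣-resp x≈y z≈w (x≤z , -x≤z) = ≤-resp x≈y z≈w x≤z , ≤-resp (-‿cong x≈y) z≈w -x≤z

  ∣∣-≤ : ∣ x ∣≤ y → y ≤ z → ∣ x ∣≤ z
  ∣∣-≤ (x≤y , -x≤y) y≤z = ≤-trans x≤y y≤z , ≤-trans -x≤y y≤z

  ∣∣-neg : ∣ x ∣≤ y → ∣ - x ∣≤ y
  ∣∣-neg {x} (x≤y , -x≤y) = -x≤y , ≤-resp (sym (-‿involutive x)) refl x≤y

  ∣∣⇒nonneg : ∣ x ∣≤ y → 0# ≤ y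
  ∣∣⇒nonneg {x} {y} (x≤y , -x≤y) y<0 =
    ≤-resp (-‿inverseʳ x) refl (+-mono-≤ x≤y -x≤y)
      (<-by (+-pos (<⇒0< y<0) (<⇒0< y<0))
        (solve 1 (λ y → (con (+ 0) :- y) :+ (con (+ 0) :- y) := con (+ 0) :- (y :+ y)) refl y))

  nonneg⇒∣∣ : 0# ≤ x → ∣ x ∣≤ x
  nonneg⇒∣∣ {x} 0≤x = ≤-refl , ≤-by (+-nonneg 0≤x 0≤x)
    (solve 1 (λ x → x :+ x := x :- :- x) refl x)

  0<2 : 0# < 1# + 1#
  0<2 = +-pos 0<1 0<1

  -- Both parts come from identities such as 2(zw - xy) = (z - x)(w + y) + (z + x)(w - y), whose
  -- factors on the right are nonnegative by hypothesis, whatever the signs of `x` and `y`.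
  ∣∣-* : ∣ x ∣≤ z → ∣ y ∣≤ w → ∣ x * y ∣≤ z * w
  ∣∣-* {x} {z} {y} {w} (x≤z , -x≤z) (y≤w , -y≤w) =
    *-cancelˡ-≤ 0<2 (≤-by (+-nonneg (*-nonneg (≤⇒0≤ x≤z) (≤⇒0≤ -y≤w))
      (*-nonneg (≤⇒0≤ -x≤z) (≤⇒0≤ y≤w)))
      (solve 4 (λ x y z w → (z :- x) :* (w :- :- y) :+ (z :- :- x) :* (w :- y)
        := con (+ 2) :* (z :* w) :- con (+ 2) :* (x :* y)) refl x y z w)) ,
    *-cancelˡ-≤ 0<2 (≤-by (+-nonneg (*-nonneg (≤⇒0≤ x≤z) (≤⇒0≤ y≤w))
      (*-nonneg (≤⇒0≤ -x≤z) (≤⇒0≤ -y≤w)))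
      (solve 4 (λ x y z w → (z :- x) :* (w :- y) :+ (z :- :- x) :* (w :- :- y)
        := con (+ 2) :* (z :* w) :- con (+ 2) :* :- (x :* y)) refl x y z w))

  bounded : ∀ x → ∃[ k ] ∣ x ∣≤ fromℕ k
  bounded x with archimedean x | archimedean (- x)
  ... | k , x<k | l , -x<l =
    k ℕ.+ l , ≤-trans (<⇒≤ x<k) (fromℕ-mono-≤ (ℕ.m≤m+n k l))
            , ≤-trans (<⇒≤ -x<l) (fromℕ-mono-≤ (ℕ.m≤n+m l k))

  -- Lets an epsilon argument end with any fixed multiple of ε. Were `x` positive, ε = x / (k + 1)
  -- would leave x - kε = ε > 0.
  ≤-multiples-of-small⇒≤0 : ∀ k → (∀ ε → 0# < ε → x ≤ fromℕ k * ε) → x ≤ 0#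
  ≤-multiples-of-small⇒≤0 {x} k x≤kε 0<x =
    x≤kε ε 0<ε (<-by 0<ε (begin
      ε                                        ≈⟨ solve 2
        (λ ε k → ε := (con (+ 1) :+ k) :* ε :- k :* ε) refl ε (fromℕ k) ⟩
      fromℕ (suc k) * ε - fromℕ k * ε          ≈⟨ +-congʳ
        (solve 3 (λ k i x → k :* (i :* x) := (i :* k) :* x) refl (fromℕ (suc k)) (1/ suc k) x) ⟩
      1/ suc k * fromℕ (suc k) * x - fromℕ k * ε ≈⟨ +-congʳ
        (trans (*-congʳ (1/-inverseˡ (suc k))) (*-identityˡ x)) ⟩
      x - fromℕ k * ε                          ∎))
    where
    open ≈-Reasoning Ring.setoid
    ε = 1/ suc k * x
    0<ε = *-pos (1/-pos (suc k)) 0<x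

  ∣∣≤-multiples-of-small⇒≈0 : ∀ k → (∀ ε → 0# < ε → ∣ x ∣≤ fromℕ k * ε) → x ≈ 0#
  ∣∣≤-multiples-of-small⇒≈0 {x} k h = ≤-antisym
    (≤-multiples-of-small⇒≤0 k (λ ε 0<ε → proj₁ (h ε 0<ε)))
    (≤-by (≤⇒0≤ (≤-multiples-of-small⇒≤0 k (λ ε 0<ε → proj₂ (h ε 0<ε))))
      (solve 1 (λ x → con (+ 0) :- :- x := x :- con (+ 0)) refl x))

-- Limits of sequences.

module Limits {c ℓ₁ ℓ₂} (ℝ : RealField c ℓ₁ ℓ₂) where
  open RealField ℝ
  open Order ℝ

  private variable
    s r q : ℕ → Carrier
    l m e b : Carrier

  limit-≤ : (∀ n → s n ≤ b) → s ⟶ l → l ≤ b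
  limit-≤ {s} {b} {l} s≤b s⟶l =
    ≤-by (≤⇒0≤ (≤-multiples-of-small⇒≤0 1 λ ε 0<ε →
      let N , close = s⟶l ε 0<ε in
      ≤-by (+-nonneg (≤⇒0≤ (proj₂ (close N ℕ.≤-refl))) (≤⇒0≤ (s≤b N)))
        (solve 4 (λ ε l b s → (ε :- :- (s :- l)) :+ (b :- s)
          := (con (+ 1) :+ con (+ 0)) :* ε :- (l :- b)) refl ε l b (s N))))
      (solve 2 (λ l b → con (+ 0) :- (l :- b) := b :- l) refl l b)

  limit-≥ : ∀ N → (∀ n → N ℕ.≤ n → b ≤ s n) → s ⟶ l → b ≤ l
  limit-≥ {b} {s} {l} M b≤s s⟶l =
    ≤-by (≤⇒0≤ (≤-multiples-of-small⇒≤0 1 λ ε 0<ε →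
      let N , close = s⟶l ε 0<ε
          n = M ℕ.⊔ N in
      ≤-by (+-nonneg (≤⇒0≤ (proj₁ (close n (ℕ.m≤n⊔m M N)))) (≤⇒0≤ (b≤s n (ℕ.m≤m⊔n M N))))
        (solve 4 (λ ε l b s → (ε :- (s :- l)) :+ (s :- b)
          := (con (+ 1) :+ con (+ 0)) :* ε :- (b :- l)) refl ε l b (s n))))
      (solve 2 (λ l b → con (+ 0) :- (b :- l) := l :- b) refl l b)

  -- `q` is a majorant whose convergence forces q (2n) - q n to 0. The 4 in the proof counts one ε
  -- for each of `s` and `r` and two for the gap.
  limit-unique : s ⟶ l → r ⟶ m → q ⟶ e →
                 (∀ n → ∣ s n - r n ∣≤ q (n ℕ.+ n) - q n) → l ≈ m
  limit-unique {s} {l} {r} {m} {q} {e} s⟶l r⟶m q⟶e s-r≤ =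
    trans (solve 2 (λ l m → l := (l :- m) :+ m) refl l m)
      (trans (+-congʳ (∣∣≤-multiples-of-small⇒≈0 4 close)) (+-identityˡ m))
    where
    close : ∀ ε → 0# < ε → ∣ l - m ∣≤ fromℕ 4 * ε
    close ε 0<ε =
      let N₁ , close₁ = s⟶l ε 0<ε
          N₂ , close₂ = r⟶m ε 0<ε
          N₃ , close₃ = q⟶e ε 0<ε
          n = N₁ ℕ.+ N₂ ℕ.+ N₃
          N₃≤n = ℕ.m≤n+m N₃ (N₁ ℕ.+ N₂)
          N₁+N₂≤n = ℕ.m≤m+n (N₁ ℕ.+ N₂) N₃
          sn = close₁ n (ℕ.≤-trans (ℕ.m≤m+n N₁ N₂) N₁+N₂≤n)
          rn = close₂ n (ℕ.≤-trans (ℕ.m≤n+m N₂ N₁) N₁+N₂≤n)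
          qn = close₃ n N₃≤n
          q2n = close₃ (n ℕ.+ n) (ℕ.≤-trans N₃≤n (ℕ.m≤m+n n n))
          2ε = ≤-by (+-nonneg (≤⇒0≤ (proj₁ q2n)) (≤⇒0≤ (proj₂ qn)))
            (solve 4 (λ ε q2 q e → (ε :- (q2 :- e)) :+ (ε :- :- (q :- e))
              := (ε :+ ε) :- (q2 :- q)) refl ε (q (n ℕ.+ n)) (q n) e)
      in ∣∣-resp
        (solve 4 (λ s r l m → :- (s :- l) :+ ((s :- r) :+ (r :- m)) := l :- m) refl (s n)
          (r n) l m)
        (solve 1 (λ ε → ε :+ ((ε :+ ε) :+ ε) :=
          (con (+ 1) :+ (con (+ 1) :+ (con (+ 1) :+ (con (+ 1) :+ con (+ 0))))) :* ε) refl ε)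
        (∣∣-+ (∣∣-neg sn) (∣∣-+ (∣∣-≤ (s-r≤ n) 2ε) rn))

  ⟶-* : ∀ k → (∀ n → ∣ r n ∣≤ fromℕ k) → s ⟶ l → r ⟶ m → (λ n → s n * r n) ⟶ l * m
  ⟶-* {r} {s} {l} {m} k ∣r∣≤k s⟶l r⟶m ε 0<ε with bounded l
  ... | j , ∣l∣≤j =
    let i = k ℕ.+ j
        -- By sr - lm = (s - l) r + l (r - m) the error is at most δ (k + j); the successor keeps
        -- the divisor nonzero.
        δ = 1/ suc i * ε
        0<δ = *-pos (1/-pos (suc i)) 0<ε
        N₁ , close₁ = s⟶l δ 0<δ
        N₂ , close₂ = r⟶m δ 0<δ
        ε≈ : fromℕ (suc i) * δ ≈ ε
        ε≈ = trans (solve 3 (λ a b x → a :* (b :* x) := (b :* a) :* x) refl (fromℕ (suc i))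
          (1/ suc i) ε)
               (trans (*-congʳ (1/-inverseˡ (suc i))) (*-identityˡ ε))
    in N₁ ℕ.⊔ N₂ , λ n N≤n → ∣∣-≤
      (∣∣-resp
        (solve 4 (λ s l r m → (s :- l) :* r :+ l :* (r :- m) := s :* r :- l :* m) refl (s n) l
          (r n) m)
        refl
        (∣∣-+ (∣∣-* (close₁ n (ℕ.≤-trans (ℕ.m≤m⊔n N₁ N₂) N≤n)) (∣r∣≤k n))
              (∣∣-* ∣l∣≤j (close₂ n (ℕ.≤-trans (ℕ.m≤n⊔m N₁ N₂) N≤n)))))
      (≤-by (<⇒≤ 0<δ)
        (trans (solve 3 (λ δ k j → δ := (con (+ 1) :+ (k :+ j)) :* δ :- (δ :* k :+ j :* δ))
          refl δ (fromℕ k) (fromℕ j))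
          (+-congʳ (trans (*-congʳ (+-congˡ (sym (fromℕ-+ k j)))) ε≈))))

-- Sums over initial segments of ℕ.

module RangeSums {c ℓ₁ ℓ₂} (ℝ : RealField c ℓ₁ ℓ₂) where
  open RealField ℝ
  open Order ℝ

  ∑ : ℕ → (ℕ → Carrier) → Carrier
  ∑ zero    f = 0#
  ∑ (suc n) f = ∑ n f + f n

  private variable f g h : ℕ → Carrier

  ∑-cong : ∀ n → (∀ i → i ℕ.< n → f i ≈ g i) → ∑ n f ≈ ∑ n g
  ∑-cong zero    f≈g = refl
  ∑-cong (suc n) f≈g = +-cong (∑-cong n (λ i i<n → f≈g i (ℕ.m<n⇒m<1+n i<n))) (f≈g n ℕ.≤-refl)

  ∑-+ : ∀ n f g → ∑ n (λ i → f i + g i) ≈ ∑ n f + ∑ n g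
  ∑-+ zero    f g = sym (+-identityˡ 0#)
  ∑-+ (suc n) f g = trans (+-congʳ (∑-+ n f g))
    (solve 4 (λ a b x y → (a :+ b) :+ (x :+ y) := (a :+ x) :+ (b :+ y)) refl _ _ (f n) (g n))

  ∑-*ˡ : ∀ n x f → ∑ n (λ i → x * f i) ≈ x * ∑ n f
  ∑-*ˡ zero    x f = sym (zeroʳ x)
  ∑-*ˡ (suc n) x f = trans (+-congʳ (∑-*ˡ n x f)) (sym (distribˡ x _ _))

  ∑-*ʳ : ∀ n x f → ∑ n (λ i → f i * x) ≈ ∑ n f * x
  ∑-*ʳ n x f = trans (∑-cong n (λ i _ → *-comm (f i) x)) (trans (∑-*ˡ n x f) (*-comm x _))

  ∑-head : ∀ n f → ∑ (suc n) f ≈ f 0 + ∑ n (f ∘ suc)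
  ∑-head zero    f = +-comm 0# (f 0)
  ∑-head (suc n) f = trans (+-congʳ (∑-head n f)) (+-assoc _ _ _)

  ∑-mono-≤ : ∀ n → (∀ i → i ℕ.< n → f i ≤ g i) → ∑ n f ≤ ∑ n g
  ∑-mono-≤ zero    f≤g = ≤-refl
  ∑-mono-≤ (suc n) f≤g = +-mono-≤ (∑-mono-≤ n (λ i i<n → f≤g i (ℕ.m<n⇒m<1+n i<n)))
    (f≤g n ℕ.≤-refl)

  ∑-∣∣ : ∀ n → (∀ i → i ℕ.< n → ∣ f i ∣≤ g i) → ∣ ∑ n f ∣≤ ∑ n g
  ∑-∣∣ zero    ∣f∣≤g = nonneg⇒∣∣ ≤-refl
  ∑-∣∣ (suc n) ∣f∣≤g = ∣∣-+ (∑-∣∣ n (λ i i<n → ∣f∣≤g i (ℕ.m<n⇒m<1+n i<n))) (∣f∣≤g n ℕ.≤-refl)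

  ∑-extend : ∀ m n → (∀ i → 0# ≤ f i) → ∑ m f ≤ ∑ (n ℕ.+ m) f
  ∑-extend m zero    0≤f = ≤-refl
  ∑-extend m (suc n) 0≤f = ≤-trans (∑-extend m n 0≤f)
    (≤-resp (+-identityʳ _) refl (+-mono-≤ ≤-refl (0≤f (n ℕ.+ m))))

-- Partial sums of the exponential series.

module ExpSeries {c ℓ₁ ℓ₂} (ℝ : RealField c ℓ₁ ℓ₂) where
  open RealField ℝ
  open Order ℝ
  open RangeSums ℝ

  private variable x y X Y : Carrier

  fromℕ-* : ∀ m n → fromℕ (m ℕ.* n) ≈ fromℕ m * fromℕ n
  fromℕ-* = Mult.×1-homo-* Ring.semiring

  1/! : ℕ → Carrier
  1/! n = (1/ (n !)) {{ℕ._!≢0 n}}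

  1/!-inverse : ∀ n → 1/! n * fromℕ (n !) ≈ 1#
  1/!-inverse n = 1/-inverseˡ (n !) {{ℕ._!≢0 n}}

  1/!-pos : ∀ n → 0# < 1/! n
  1/!-pos n = 1/-pos (n !) {{ℕ._!≢0 n}}

  1/!-suc : ∀ n → fromℕ (suc n) * 1/! (suc n) ≈ 1/! n
  1/!-suc n = *-cancelˡ-≈ (fromℕ-pos {n !} (ℕ.1≤n! n)) $ begin
    fromℕ (n !) * (fromℕ (suc n) * 1/! (suc n))   ≈⟨ solve 3
      (λ a b c → a :* (b :* c) := c :* (b :* a)) refl _ _ _ ⟩
    1/! (suc n) * (fromℕ (suc n) * fromℕ (n !))   ≈⟨ *-congˡ (fromℕ-* (suc n) (n !)) ⟨
    1/! (suc n) * fromℕ (suc n !)                 ≈⟨ 1/!-inverse (suc n) ⟩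
    1#                                            ≈⟨ 1/!-inverse n ⟨
    1/! n * fromℕ (n !)                           ≈⟨ *-comm _ _ ⟩
    fromℕ (n !) * 1/! n                           ∎
    where open ≈-Reasoning Ring.setoid

  term : Carrier → ℕ → Carrier
  term x n = x ^ n * 1/! n

  term-zero : ∀ x → term x 0 ≈ 1#
  term-zero x = trans (*-identityˡ _) (trans (sym (*-identityʳ _))
    (trans (*-congˡ (sym (+-identityʳ 1#))) (1/!-inverse 0)))

  -- The coefficientwise form of exp′ = exp. The addition formula for terms rests on this recurrence
  -- and on `term-zero`.
  term-suc : ∀ x n → fromℕ (suc n) * term x (suc n) ≈ x * term x n
  term-suc x n = trans
    (solve 4 (λ k x p i → k :* (x :* p :* i) := x :* (p :* (k :* i))) refl (fromℕ (suc n)) x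
      (x ^ n) (1/! (suc n)))
    (*-congˡ (*-congˡ (1/!-suc n)))

  term-cong : x ≈ y → ∀ n → term x n ≈ term y n
  term-cong {x} {y} x≈y n = *-congʳ (^-cong n)
    where
    ^-cong : ∀ n → x ^ n ≈ y ^ n
    ^-cong zero    = refl
    ^-cong (suc n) = *-cong x≈y (^-cong n)

  ∣term∣ : ∣ x ∣≤ X → ∀ n → ∣ term x n ∣≤ term X n
  ∣term∣ {x} {X} ∣x∣≤X n = ∣∣-* (∣^∣ n) (nonneg⇒∣∣ (<⇒≤ (1/!-pos n)))
    where
    ∣^∣ : ∀ n → ∣ x ^ n ∣≤ X ^ n
    ∣^∣ zero    = nonneg⇒∣∣ 0≤1
    ∣^∣ (suc n) = ∣∣-* ∣x∣≤X (∣^∣ n)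

  term-nonneg : 0# ≤ x → ∀ n → 0# ≤ term x n
  term-nonneg 0≤x n = ∣∣⇒nonneg (∣term∣ (nonneg⇒∣∣ 0≤x) n)

  expSeries-∑ : ∀ x n → expSeries x n ≈ ∑ n (term x)
  expSeries-∑ x zero    = refl
  expSeries-∑ x (suc n) = +-congʳ (expSeries-∑ x n)

  expSeries-cong : x ≈ y → ∀ n → expSeries x n ≈ expSeries y n
  expSeries-cong x≈y zero    = refl
  expSeries-cong x≈y (suc n) = +-cong (expSeries-cong x≈y n) (term-cong x≈y n)

  ∣expSeries-∣ : ∣ x ∣≤ X → ∀ {m n} → m ℕ.≤ n →
                 ∣ expSeries x n - expSeries x m ∣≤ expSeries X n - expSeries X m
  ∣expSeries-∣ {x} {X} ∣x∣≤X {m} m≤n = go (ℕ.≤⇒≤′ m≤n)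
    where
    go : ∀ {n} → m ℕ.≤′ n → ∣ expSeries x n - expSeries x m ∣≤ expSeries X n - expSeries X m
    go (ℕ.≤′-reflexive ≡.refl) = ∣∣-resp (sym (-‿inverseʳ _)) (sym (-‿inverseʳ _))
      (nonneg⇒∣∣ ≤-refl)
    go (ℕ.≤′-step {n} m≤n) = ∣∣-resp (shuffle x) (shuffle X) (∣∣-+ (go m≤n) (∣term∣ ∣x∣≤X n))
      where
      shuffle : ∀ z → (expSeries z n - expSeries z m) + term z n ≈ expSeries z
        (suc n) - expSeries z m
      shuffle z = solve 3 (λ a b t → (a :- b) :+ t := (a :+ t) :- b) refl _ _ _

  expSeries-mono : 0# ≤ x → ∀ {m n} → m ℕ.≤ n → expSeries x m ≤ expSeries x n
  expSeries-mono 0≤x m≤n = ≤-by (∣∣⇒nonneg (∣expSeries-∣ (nonneg⇒∣∣ 0≤x) m≤n)) refl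

  expSeries-nonneg : 0# ≤ x → ∀ n → 0# ≤ expSeries x n
  expSeries-nonneg 0≤x n = expSeries-mono 0≤x {n = n} z≤n

  private
    convolution : Carrier → Carrier → ℕ → Carrier
    convolution x y n = ∑ (suc n) (λ i → term x i * term y (n ∸ i))

    -- The Leibniz rule for a Cauchy product: write n + 1 as i + (n + 1 - i) and let `term-suc`
    -- absorb each weight into its own factor. The summands of weight 0, at i = 0 and at i = n + 1,
    -- drop out.
    convolution-suc : ∀ x y n →
      fromℕ (suc n) * convolution x y (suc n) ≈ (x + y) * convolution x y n
    convolution-suc x y n = begin
      fromℕ (suc n) * ∑ (2 ℕ.+ n) u                     ≈⟨ ∑-*ˡ (2 ℕ.+ n) _ u ⟨
      ∑ (2 ℕ.+ n) (λ i → fromℕ (suc n) * u i)           ≈⟨ ∑-cong (2 ℕ.+ n) split ⟩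
      ∑ (2 ℕ.+ n) (λ i → uˡ i + uʳ i)                   ≈⟨ ∑-+ (2 ℕ.+ n) uˡ uʳ ⟩
      ∑ (2 ℕ.+ n) uˡ + ∑ (2 ℕ.+ n) uʳ                   ≈⟨ +-cong left right ⟩
      x * convolution x y n + y * convolution x y n     ≈⟨ distribʳ _ x y ⟨
      (x + y) * convolution x y n                       ∎
      where
      open ≈-Reasoning Ring.setoid
      u uˡ uʳ : ℕ → Carrier
      u i = term x i * term y (suc n ∸ i)
      uˡ i = (fromℕ i * term x i) * term y (suc n ∸ i)
      uʳ i = term x i * (fromℕ (suc n ∸ i) * term y (suc n ∸ i))

      split : ∀ i → i ℕ.< 2 ℕ.+ n → fromℕ (suc n) * u i ≈ uˡ i + uʳ i
      split i (s≤s i≤1+n) = trans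
        (*-congʳ (trans (reflexive (≡.cong fromℕ (≡.sym (ℕ.m+[n∸m]≡n i≤1+n))))
          (fromℕ-+ i (suc n ∸ i))))
        (solve 4 (λ i j a b → (i :+ j) :* (a :* b) := (i :* a) :* b :+ a :* (j :* b)) refl
          (fromℕ i) (fromℕ (suc n ∸ i)) (term x i) (term y (suc n ∸ i)))

      left : ∑ (2 ℕ.+ n) uˡ ≈ x * convolution x y n
      left = begin
        ∑ (2 ℕ.+ n) uˡ                ≈⟨ ∑-head (suc n) uˡ ⟩
        uˡ 0 + ∑ (suc n) (uˡ ∘ suc)   ≈⟨ +-congʳ (trans (*-congʳ (zeroˡ _)) (zeroˡ _)) ⟩
        0# + ∑ (suc n) (uˡ ∘ suc)     ≈⟨ +-identityˡ _ ⟩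
        ∑ (suc n) (uˡ ∘ suc)          ≈⟨ ∑-cong (suc n)
          (λ i _ → trans (*-congʳ (term-suc x i)) (*-assoc _ _ _)) ⟩
        ∑ (suc n) (λ i → x * (term x i * term y (n ∸ i)))  ≈⟨ ∑-*ˡ (suc n) x _ ⟩
        x * convolution x y n         ∎

      right : ∑ (2 ℕ.+ n) uʳ ≈ y * convolution x y n
      right = begin
        ∑ (suc n) uʳ + uʳ (suc n)     ≈⟨ +-congˡ
          (*-congˡ (*-congʳ (reflexive (≡.cong fromℕ (ℕ.n∸n≡0 n))))) ⟩
        ∑ (suc n) uʳ + term x (suc n) * (0# * _)
          ≈⟨ solve 3 (λ s a b → s :+ a :* (con (+ 0) :* b) := s) refl _ _ _ ⟩
        ∑ (suc n) uʳ                  ≈⟨ ∑-cong (suc n) step ⟩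
        ∑ (suc n) (λ i → y * (term x i * term y (n ∸ i)))  ≈⟨ ∑-*ˡ (suc n) y _ ⟩
        y * convolution x y n         ∎
        where
        step : ∀ i → i ℕ.< suc n → uʳ i ≈ y * (term x i * term y (n ∸ i))
        step i (s≤s i≤n) rewrite ℕ.+-∸-assoc 1 i≤n = trans (*-congˡ (term-suc y (n ∸ i)))
          (solve 3 (λ a y b → a :* (y :* b) := y :* (a :* b)) refl (term x i) y
            (term y (n ∸ i)))

  -- The binomial theorem with the factorials divided out: both sides agree at 0 and satisfy the
  -- same recurrence.
  term-+ : ∀ x y n → ∑ (suc n) (λ i → term x i * term y (n ∸ i)) ≈ term (x + y) n
  term-+ x y zero = trans (+-identityˡ _)
    (trans (*-cong (term-zero x) (term-zero y))
      (trans (*-identityˡ 1#) (sym (term-zero (x + y)))))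
  term-+ x y (suc n) = *-cancelˡ-≈ (fromℕ-pos {suc n} (s≤s z≤n))
    (trans (convolution-suc x y n) (trans (*-congˡ (term-+ x y n)) (sym (term-suc (x + y) n))))

  -- The right side sums `term x i * term y j` over the triangle i + j < n. Raising n by one adds
  -- the diagonal i + j = n, which is `term-+`.
  expSeries-+ : ∀ x y n → expSeries (x + y) n ≈ ∑ n (λ i → term x i * expSeries y (n ∸ i))
  expSeries-+ x y zero    = refl
  expSeries-+ x y (suc n) = begin
    expSeries (x + y) n + term (x + y) n
      ≈⟨ +-cong (expSeries-+ x y n) (sym (term-+ x y n)) ⟩
    ∑ n low + ∑ (suc n) (λ i → term x i * term y (n ∸ i))
      ≈⟨ +-congʳ (trans (sym (+-identityʳ _)) (+-congˡ (sym last≈0))) ⟩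
    ∑ (suc n) low + ∑ (suc n) (λ i → term x i * term y (n ∸ i))
      ≈⟨ ∑-+ (suc n) low _ ⟨
    ∑ (suc n) (λ i → low i + term x i * term y (n ∸ i))
      ≈⟨ ∑-cong (suc n) step ⟩
    ∑ (suc n) (λ i → term x i * expSeries y (suc n ∸ i)) ∎
    where
    open ≈-Reasoning Ring.setoid
    low : ℕ → Carrier
    low i = term x i * expSeries y (n ∸ i)
    last≈0 : low n ≈ 0#
    last≈0 = trans (*-congˡ (reflexive (≡.cong (expSeries y) (ℕ.n∸n≡0 n)))) (zeroʳ _)
    step : ∀ i → i ℕ.< suc n → low i + term x i * term y (n ∸ i) ≈ term x i * expSeries y
      (suc n ∸ i)
    step i (s≤s i≤n) rewrite ℕ.+-∸-assoc 1 i≤n = sym (distribˡ (term x i) _ _)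

  -- What is left of the square i, j < n once the triangle i + j < n is removed.
  product-defect : ∀ x y n → expSeries x n * expSeries y n - expSeries (x + y) n ≈
                   ∑ n (λ i → term x i * (expSeries y n - expSeries y (n ∸ i)))
  product-defect x y n = begin
    expSeries x n * expSeries y n - expSeries (x + y) n
      ≈⟨ +-cong (*-congʳ (expSeries-∑ x n)) (-‿cong (expSeries-+ x y n)) ⟩
    ∑ n (term x) * expSeries y n - ∑ n (λ i → term x i * expSeries y (n ∸ i))
      ≈⟨ +-congʳ (trans (sym (∑-*ʳ n _ (term x))) (trans (∑-cong n λ i _ →
           solve 3 (λ t a b → t :* a := t :* (a :- b) :+ t :* b) refl (term x i) (expSeries y n)
             (expSeries y (n ∸ i)))
           (∑-+ n _ _))) ⟩
    (∑ n (λ i → term x i * (expSeries y n - expSeries y (n ∸ i))) + ∑ n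
      (λ i → term x i * expSeries y (n ∸ i)))
      - ∑ n (λ i → term x i * expSeries y (n ∸ i))
      ≈⟨ solve 2 (λ a b → (a :+ b) :- b := a) refl _ _ ⟩
    ∑ n (λ i → term x i * (expSeries y n - expSeries y (n ∸ i))) ∎
    where open ≈-Reasoning Ring.setoid

  -- The product defect is a polynomial in x and y with nonnegative coefficients,
  -- all of them among those of the terms of index n, …, 2n - 1 of exp (x + y).
  ∣product-defect∣ : ∣ x ∣≤ X → ∣ y ∣≤ Y → ∀ n →
    ∣ expSeries x n * expSeries y n - expSeries (x + y) n ∣≤
      expSeries (X + Y) (n ℕ.+ n) - expSeries (X + Y) n
  ∣product-defect∣ {x} {X} {y} {Y} ∣x∣≤X ∣y∣≤Y n = ∣∣-≤
    (∣∣-resp (sym (product-defect x y n)) (sym (product-defect X Y n))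
      (∑-∣∣ n λ i _ → ∣∣-* (∣term∣ ∣x∣≤X i) (∣expSeries-∣ ∣y∣≤Y (ℕ.m∸n≤m n i))))
    (+-mono-≤ product≤ ≤-refl)
    where
    0≤X = ∣∣⇒nonneg ∣x∣≤X
    0≤Y = ∣∣⇒nonneg ∣y∣≤Y
    product≤ : expSeries X n * expSeries Y n ≤ expSeries (X + Y) (n ℕ.+ n)
    product≤ = ≤-resp
      (trans (∑-*ʳ n _ (term X)) (*-congʳ (sym (expSeries-∑ X n))))
      (sym (expSeries-+ X Y (n ℕ.+ n)))
      (≤-trans
        (∑-mono-≤ n λ i i<n → *-monoˡ-≤ (term-nonneg 0≤X i) (expSeries-mono 0≤Y
          (≡.subst (ℕ._≤ n ℕ.+ n ∸ i) (ℕ.m+n∸n≡m n i)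
            (ℕ.∸-monoˡ-≤ i (ℕ.+-monoʳ-≤ n (ℕ.<⇒≤ i<n))))))
        (∑-extend n n λ i → *-nonneg (term-nonneg 0≤X i) (expSeries-nonneg 0≤Y (n ℕ.+ n ∸ i))))

-- The exponential function: addition law and tangent-line bound.

module Exponential {c ℓ₁ ℓ₂} (ℝ : RealField c ℓ₁ ℓ₂) (expLn : ExpLn ℝ) where
  open RealField ℝ
  open ExpLn expLn
  open Order ℝ
  open Limits ℝ
  open RangeSums ℝ
  open ExpSeries ℝ

  private variable x y : Carrier

  -- `exp` is a bare function on the carrier, so its compatibility with `_≈_` is derived from the
  -- series, with the constant 0 as majorant.
  exp-cong : x ≈ y → exp x ≈ exp y
  exp-cong {x} {y} x≈y = limit-unique (exp-series x) (exp-series y) 0⟶0 λ n →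
    ∣∣-resp (sym (trans (+-congʳ (expSeries-cong x≈y n)) (-‿inverseʳ _))) (sym (-‿inverseʳ 0#))
      (nonneg⇒∣∣ ≤-refl)
    where
    0⟶0 : (λ _ → 0#) ⟶ 0#
    0⟶0 ε 0<ε = 0 , λ _ _ → ∣∣-≤ (∣∣-resp (sym (-‿inverseʳ 0#)) refl (nonneg⇒∣∣ ≤-refl))
      (<⇒≤ 0<ε)

  expSeries≤exp : 0# ≤ x → ∀ n → expSeries x n ≤ exp x
  expSeries≤exp {x} 0≤x n = limit-≥ n (λ _ → expSeries-mono 0≤x) (exp-series x)

  -- Products of partial sums tend to `exp x * exp y`, and by `∣product-defect∣` their distance from
  -- the partial sums at `x + y` is at most a block of the series at `k + l`.
  exp-+ : ∀ x y → exp (x + y) ≈ exp x * exp y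
  exp-+ x y =
    let k , ∣x∣≤k = bounded x
        l , ∣y∣≤l = bounded y
        -- `⟶-*` asks for a bound on the partial sums at `y` uniform in n; the majorant series at
        -- `l` stays below its limit.
        K , ∣expl∣≤K = bounded (exp (fromℕ l))
    in sym (limit-unique
         (⟶-* K
           (λ n → ∣∣-≤ (∣∣-resp (x-0≈x _) (x-0≈x _) (∣expSeries-∣ ∣y∣≤l {0} {n} z≤n))
                       (≤-trans (expSeries≤exp (fromℕ-nonneg l) n) (proj₁ ∣expl∣≤K)))
           (exp-series x) (exp-series y))
         (exp-series (x + y)) (exp-series (fromℕ k + fromℕ l))
         (∣product-defect∣ ∣x∣≤k ∣y∣≤l))
    where
    x-0≈x : ∀ x → x - 0# ≈ x
    x-0≈x x = solve 1 (λ x → x :- con (+ 0) := x) refl x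

  exp0≈1 : exp 0# ≈ 1#
  exp0≈1 = *-cancelˡ-≈ (exp-pos 0#)
    (trans (sym (exp-+ 0# 0#)) (trans (exp-cong (+-identityˡ 0#)) (sym (*-identityʳ _))))

  exp-inverse : ∀ x → exp x * exp (- x) ≈ 1#
  exp-inverse x = trans (sym (exp-+ x (- x))) (trans (exp-cong (-‿inverseʳ x)) exp0≈1)

  private
    1+x≤exp-nonneg : 0# ≤ x → 1# + x ≤ exp x
    1+x≤exp-nonneg {x} 0≤x = ≤-resp two-terms refl (expSeries≤exp 0≤x 2)
      where
      term-one : term x 1 ≈ x
      term-one = trans (solve 1 (λ a → a := (con (+ 1) :+ con (+ 0)) :* a) refl _)
        (trans (term-suc x 0) (trans (*-congˡ (term-zero x)) (*-identityʳ x)))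
      two-terms : expSeries x 2 ≈ 1# + x
      two-terms = +-cong (trans (+-identityˡ _) (term-zero x)) term-one

    -- Prepares the tangent-line bound at negative arguments: multiplied by `exp (- x)` it reads 1 ≤
    -- exp (- x) + x. It holds because each term is at most `x` times the preceding one.
    exp≤1+x*exp : 0# ≤ x → exp x ≤ 1# + x * exp x
    exp≤1+x*exp {x} 0≤x = limit-≤ (λ n → ≤-trans (expSeries-mono 0≤x (ℕ.n≤1+n n)) (bound n))
      (exp-series x)
      where
      term-suc≤ : ∀ n → term x (suc n) ≤ x * term x n
      term-suc≤ n = ≤-resp refl (term-suc x n)
        (≤-by (*-nonneg (fromℕ-nonneg n) (term-nonneg 0≤x (suc n)))
          (solve 2 (λ k a → k :* a := (con (+ 1) :+ k) :* a :- a) refl (fromℕ n)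
            (term x (suc n))))
      bound : ∀ n → expSeries x (suc n) ≤ 1# + x * exp x
      bound n = ≤-resp (sym (trans (expSeries-∑ x (suc n)) (∑-head n (term x)))) refl
        (+-mono-≤ (≈⇒≤ (term-zero x))
          (≤-trans (∑-mono-≤ n λ i _ → term-suc≤ i)
            (≤-trans (≈⇒≤ (trans (∑-*ˡ n x (term x)) (*-congˡ (sym (expSeries-∑ x n)))))
              (*-monoˡ-≤ 0≤x (expSeries≤exp 0≤x n)))))

  1+x≤exp : ∀ x → 1# + x ≤ exp x
  1+x≤exp x exp<1+x = ≤-⊎-> 0# x λ where
    (inj₁ 0≤x) → 1+x≤exp-nonneg 0≤x exp<1+x
    (inj₂ x<0) →
      let k = - x
          0≤k = ≤-by (≤⇒0≤ (<⇒≤ x<0))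
            (solve 1 (λ x → con (+ 0) :- x := :- x :- con (+ 0)) refl x)
          k*exp≈ = trans (solve 3 (λ e f k → e :* (con (+ 1) :+ k :* f) := e :+ (e :* f) :* k)
            refl (exp x) (exp k) k)
                         (+-congˡ (trans (*-congʳ (exp-inverse x)) (*-identityˡ k)))
          1≤exp+k = ≤-resp (exp-inverse x) k*exp≈
            (*-monoˡ-≤ (<⇒≤ (exp-pos x)) (exp≤1+x*exp 0≤k))
      in ≤-by (≤⇒0≤ 1≤exp+k) (solve 2 (λ e x → (e :+ :- x) :- con (+ 1) := e :-
           (con (+ 1) :+ x)) refl (exp x) x) exp<1+x

  exp-mono-≤ : x ≤ y → exp x ≤ exp y
  exp-mono-≤ {x} {y} x≤y = ≤-resp (*-identityʳ _)
    (trans (sym (exp-+ x (y - x))) (exp-cong (solve 2 (λ x y → x :+ (y :- x) := y) refl x y)))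
    (*-monoˡ-≤ (<⇒≤ (exp-pos x)) (≤-trans
      (≤-by (≤⇒0≤ x≤y) (solve 2 (λ x y → y :- x := (con (+ 1) :+ (y :- x)) :- con (+ 1))
        refl x y))
      (1+x≤exp (y - x))))

  1≤exp⇒0≤ : 1# ≤ exp x → 0# ≤ x
  1≤exp⇒0≤ {x} 1≤exp = ≤-by (≤⇒0≤ (≤-trans (1+x≤exp (- x)) exp-x≤1))
    (solve 1 (λ x → con (+ 1) :- (con (+ 1) :+ :- x) := x :- con (+ 0)) refl x)
    where
    exp-x≤1 : exp (- x) ≤ 1#
    exp-x≤1 = ≤-resp (*-identityʳ _) (trans (*-comm _ _) (exp-inverse x))
      (*-monoˡ-≤ (<⇒≤ (exp-pos (- x))) 1≤exp)

  -- (exp x - 1)² = exp x (exp x + exp (- x) - 2)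
  exp+exp⁻≤2⇒≈0 : exp x + exp (- x) ≤ 1# + 1# → x ≈ 0#
  exp+exp⁻≤2⇒≈0 {x} sum≤2 = ≤-antisym
    (≤-by (≤⇒0≤ (1≤exp⇒0≤ (≈⇒≤ (sym exp-x≈1))))
      (solve 1 (λ x → :- x :- con (+ 0) := con (+ 0) :- x) refl x))
    (1≤exp⇒0≤ (≈⇒≤ (sym exp≈1)))
    where
    square≤0 : (exp x - 1#) * (exp x - 1#) ≤ 0#
    square≤0 = ≤-by (*-nonneg (<⇒≤ (exp-pos x)) (≤⇒0≤ sum≤2)) $
      trans (solve 2 (λ e f → e :* (con (+ 2) :- (e :+ f))
              := con (+ 2) :* e :- e :* e :- e :* f) refl (exp x) (exp (- x)))
        (trans (+-congˡ (-‿cong (exp-inverse x)))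
          (solve 1 (λ e → con (+ 2) :* e :- e :* e :- con (+ 1)
              := con (+ 0) :- (e :- con (+ 1)) :* (e :- con (+ 1))) refl (exp x)))
    exp≈1 : exp x ≈ 1#
    exp≈1 = trans (solve 1 (λ e → e := (e :- con (+ 1)) :+ con (+ 1)) refl (exp x))
      (trans (+-congʳ (square≤0⇒≈0 square≤0)) (+-identityˡ 1#))
    exp-x≈1 : exp (- x) ≈ 1#
    exp-x≈1 = trans (sym (*-identityˡ _)) (trans (*-congʳ (sym exp≈1)) (exp-inverse x))

-- Finite families and sums over them.

-- Allows finitely many undecidable propositions to be decided at once inside a proof of `⊥`.
¬¬-Fin : ∀ {p n} {P : Fin n → Set p} → (∀ i → ¬ ¬ P i) → ¬ ¬ (∀ i → P i)
¬¬-Fin {n = zero}  ¬¬P k = k λ ()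
¬¬-Fin {n = suc n} ¬¬P k = ¬¬P zero λ P₀ → ¬¬-Fin (¬¬P ∘ suc) λ Pₛ →
  k λ { zero → P₀ ; (suc i) → Pₛ i }

module FiniteSums {c ℓ₁ ℓ₂} (ℝ : RealField c ℓ₁ ℓ₂) where
  open RealField ℝ
  open Order ℝ
  open Sum Ring.semiring public using (∑-distrib-+; *-distribˡ-sum)

  private variable n : ℕ

  sum-cong : {f g : Fin n → Carrier} → (∀ i → f i ≈ g i) → sum f ≈ sum g
  sum-cong = Sum.sum-cong-≋ Ring.semiring

  sum-const : ∀ n x → sum {n} (λ _ → x) ≈ fromℕ n * x
  sum-const zero    x = sym (zeroˡ x)
  sum-const (suc n) x = trans (+-congˡ (sum-const n x))
    (solve 2 (λ k x → x :+ k :* x := (con (+ 1) :+ k) :* x) refl (fromℕ n) x)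

  sum-mono-≤ : {f g : Fin n → Carrier} → (∀ i → f i ≤ g i) → sum f ≤ sum g
  sum-mono-≤ {zero}  f≤g = ≤-refl
  sum-mono-≤ {suc n} f≤g = +-mono-≤ (f≤g zero) (sum-mono-≤ (f≤g ∘ suc))

  -- The equality case of monotonicity: the reversed totals leave no room for a strict summand. This
  -- later turns maximality into an equality at each vertex.
  sum-mono-≤-tight : {f g : Fin n → Carrier} →
    (∀ i → f i ≤ g i) → sum g ≤ sum f → ∀ i → g i ≤ f i
  sum-mono-≤-tight {suc n} {f} {g} f≤g Σg≤Σf zero =
    ≤-by (+-nonneg (≤⇒0≤ Σg≤Σf) (≤⇒0≤ (sum-mono-≤ (f≤g ∘ suc))))
      (solve 4 (λ f g F G → ((f :+ F) :- (g :+ G)) :+ (G :- F) := f :- g) refl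
        (f zero) (g zero) (sum (f ∘ suc)) (sum (g ∘ suc)))
  sum-mono-≤-tight {suc n} {f} {g} f≤g Σg≤Σf (suc i) = sum-mono-≤-tight (f≤g ∘ suc)
    (≤-by (+-nonneg (≤⇒0≤ Σg≤Σf) (≤⇒0≤ (f≤g zero)))
      (solve 4 (λ f g F G → ((f :+ F) :- (g :+ G)) :+ (g :- f) := F :- G) refl
        (f zero) (g zero) (sum (f ∘ suc)) (sum (g ∘ suc)))) i

  indicator : ∀ {p} {P : Set p} → Dec P → Carrier
  indicator P? = if does P? then 1# else 0#

  indicator-yes : ∀ {p} {P : Set p} (P? : Dec P) → P → indicator P? ≈ 1#
  indicator-yes (yes _) _ = refl
  indicator-yes (no ¬p) p = contradiction p ¬p

  indicator-no : ∀ {p} {P : Set p} (P? : Dec P) → ¬ P → indicator P? ≈ 0#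
  indicator-no (yes p) ¬p = contradiction p ¬p
  indicator-no (no _)  _  = refl

  sum-at : ∀ (f : Fin n → Carrier) i → sum (λ j → f j * indicator (i Fin.≟ j)) ≈ f i
  sum-at {suc n} f zero = trans
    (+-cong (*-identityʳ _) (trans (sum-cong {g = λ _ → 0#} λ j → zeroʳ (f (suc j)))
      (trans (sum-const n 0#) (zeroʳ _))))
    (+-identityʳ _)
  sum-at {suc n} f (suc i) = trans (+-cong (zeroʳ _) (sum-at (f ∘ suc) i)) (+-identityˡ _)

-- Integers inside the reals.

module Integers {c ℓ₁ ℓ₂} (ℝ : RealField c ℓ₁ ℓ₂) where
  open RealField ℝ
  open Order ℝ

  private variable x y : Carrier

  IsInteger : Carrier → Set ℓ₁
  IsInteger x = ∃[ z ] x ≈ fromℤ z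

  isInteger-≈ : x ≈ y → IsInteger x → IsInteger y
  isInteger-≈ x≈y (z , x≈z) = z , trans (sym x≈y) x≈z

  isInteger-+ : IsInteger x → IsInteger y → IsInteger (x + y)
  isInteger-+ (z , x≈z) (w , y≈w) = z ℤ.+ w , trans (+-cong x≈z y≈w) (sym (fromℤ-+ z w))

  isInteger-neg : IsInteger x → IsInteger (- x)
  isInteger-neg (z , x≈z) = ℤ.- z , trans (-‿cong x≈z) (sym (fromℤ-neg z))

  isInteger-fromℕ : ∀ n → IsInteger (fromℕ n)
  isInteger-fromℕ n = + n , fromℕ≈fromℤ n

  isInteger-sum : ∀ {n} {f : Fin n → Carrier} → (∀ i → IsInteger (f i)) → IsInteger (sum f)
  isInteger-sum {zero}  _     = + 0 , refl
  isInteger-sum {suc n} int-f = isInteger-+ (int-f zero) (isInteger-sum (int-f ∘ suc))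

  fromℤ-pos : ∀ n → 0# < fromℤ (+ suc n)
  fromℤ-pos n = <.<-respʳ-≈ (fromℕ≈fromℤ (suc n)) (fromℕ-pos {suc n} (s≤s z≤n))

  fromℤ-neg< : ∀ n → fromℤ -[1+ n ] < 0#
  fromℤ-neg< n = <-by (fromℤ-pos n)
    (solve 1 (λ a → a := con (+ 0) :- :- a) refl (fromℤ (+ suc n)))

  0<? : IsInteger x → Dec (0# < x)
  0<? (+ zero   , x≈0) = no λ 0<x → ≈⇒≤ x≈0 0<x
  0<? (+ suc n  , x≈z) = yes (<.<-respʳ-≈ (sym x≈z) (fromℤ-pos n))
  0<? (-[1+ n ] , x≈z) = no λ 0<x → <.asym 0<x (<.<-respˡ-≈ (sym x≈z) (fromℤ-neg< n))

  ≈0? : IsInteger x → Dec (x ≈ 0#)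
  ≈0? (+ zero   , x≈0) = yes x≈0
  ≈0? (+ suc n  , x≈z) = no λ x≈0 → ≈⇒≤ (trans (sym x≈z) x≈0) (fromℤ-pos n)
  ≈0? (-[1+ n ] , x≈z) = no λ x≈0 → ≈⇒≤ (trans (sym x≈0) x≈z) (fromℤ-neg< n)

  ∣integer∣<1⇒≈0 : IsInteger x → x < 1# → - x < 1# → x ≈ 0#
  ∣integer∣<1⇒≈0 (+ zero , x≈0) _ _ = x≈0
  ∣integer∣<1⇒≈0 {x} (+ suc n , x≈z) x<1 _ = contradiction x<1
    (≤-resp (+-identityʳ 1#) (trans (fromℕ≈fromℤ (suc n)) (sym x≈z))
      (fromℕ-mono-≤ {1} {suc n} (s≤s z≤n)))
  ∣integer∣<1⇒≈0 {x} (-[1+ n ] , x≈z) _ -x<1 = contradiction -x<1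
    (≤-resp (+-identityʳ 1#) (trans (fromℕ≈fromℤ (suc n))
      (trans (sym (-‿involutive _)) (-‿cong (sym x≈z))))
      (fromℕ-mono-≤ {1} {suc n} (s≤s z≤n)))

  private
    -- The bound makes the search finite. Given x < k + 2, comparing `x` with k < k + 1 either
    -- lowers the bound or gives k < x < k + 2, where `suc k` is the only candidate. The witness is
    -- thus computed, and only its equality with `x` uses the double negation.
    isNatural-stable : ∀ k x → x < fromℕ (suc k) → ¬ ¬ (∃[ m ] x ≈ fromℕ m) → ∃[ m ] x ≈ fromℕ m
    isNatural-stable zero x x<1 ¬¬nat = 0 , ≈-stable λ x≉0 → ¬¬nat λ where
      (zero  , x≈0) → x≉0 x≈0
      (suc m , x≈m) → fromℕ-mono-≤ {1} {suc m} (s≤s z≤n) (<.<-respˡ-≈ x≈m x<1)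
    isNatural-stable (suc k) x x<2+k ¬¬nat = case (<-cotrans (fromℕ-mono-< (ℕ.n<1+n k)) x)
      where
      case : fromℕ k < x ⊎ x < fromℕ (suc k) → ∃[ m ] x ≈ fromℕ m
      case (inj₂ x<1+k) = isNatural-stable k x x<1+k ¬¬nat
      case (inj₁ k<x)   = suc k , ≈-stable λ x≉1+k → ¬¬nat λ (m , x≈m) →
        x≉1+k (trans x≈m (reflexive (≡.cong fromℕ {m} {suc k} (ℕ.≤-antisym
          (ℕ.≮⇒≥ λ 1+k<m → fromℕ-mono-≤ 1+k<m (<.<-respˡ-≈ x≈m x<2+k))
          (ℕ.≮⇒≥ λ { (s≤s m≤k) → fromℕ-mono-≤ m≤k (<.<-respʳ-≈ x≈m k<x) })))))

  isInteger-stable : ∀ k → ∣ x ∣≤ fromℕ k → ¬ ¬ IsInteger x → IsInteger x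
  isInteger-stable {x} k (x≤k , -x≤k) ¬¬int = unshift
    (isNatural-stable (k ℕ.+ k) (x + fromℕ k)
      (≤-<-trans (≤-resp refl (sym (fromℕ-+ k k)) (+-mono-≤ x≤k ≤-refl))
        (fromℕ-mono-< (ℕ.n<1+n (k ℕ.+ k))))
      (λ ¬nat → ¬¬int λ int → ¬nat (natural (isInteger-+ int (isInteger-fromℕ k)))))
    where
    natural : IsInteger (x + fromℕ k) → ∃[ m ] x + fromℕ k ≈ fromℕ m
    natural (+ m      , x+k≈m) = m , trans x+k≈m (sym (fromℕ≈fromℤ m))
    natural (-[1+ m ] , x+k≈m) = contradiction (<.<-respˡ-≈ (sym x+k≈m) (fromℤ-neg< m))
      (≤-by (≤⇒0≤ -x≤k) (solve 2 (λ x k → k :- :- x := (x :+ k) :- con (+ 0)) refl x (fromℕ k)))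
    unshift : ∃[ m ] x + fromℕ k ≈ fromℕ m → IsInteger x
    unshift (m , x+k≈m) = isInteger-≈
      (trans (+-congʳ (sym x+k≈m)) (solve 2 (λ x k → (x :+ k) :- k := x) refl x (fromℕ k)))
      (isInteger-+ (isInteger-fromℕ m) (isInteger-neg (isInteger-fromℕ k)))

-- Geodesics in the graph.

module Distances (G : FiniteConnectedGraph) where
  open FiniteConnectedGraph G

  private variable
    u v w : Vertex
    k : ℕ

  geodesic : ∀ u v → Walk _~_ u v (dist u v)
  geodesic u v = proj₁ (proj₂ (shortest u v))

  dist-≤ : Walk _~_ u v k → dist u v ℕ.≤ k
  dist-≤ {u} {v} = proj₂ (proj₂ (shortest u v)) _

  reverse : Walk _~_ u v k → Walk _~_ v u k
  reverse []      = []
  reverse (e ∷ p) = snoc (reverse p) (~-sym e)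
    where
    snoc : ∀ {u v w k} → Walk _~_ u v k → v ~ w → Walk _~_ u w (suc k)
    snoc []      e = e ∷ []
    snoc (d ∷ p) e = d ∷ snoc p e

  dist-sym : ∀ u v → dist u v ≡ dist v u
  dist-sym u v = ℕ.≤-antisym (dist-≤ (reverse (geodesic v u))) (dist-≤ (reverse (geodesic u v)))

  geodesic-head : u ≢ v → ∃[ w ] u ~ w × suc (dist w v) ℕ.≤ dist u v
  geodesic-head {u} {v} u≢v = head (geodesic u v)
    where
    head : ∀ {k} → Walk _~_ u v k → ∃[ w ] u ~ w × suc (dist w v) ℕ.≤ k
    head []      = contradiction ≡.refl u≢v
    head (e ∷ p) = _ , e , s≤s (dist-≤ p)

-- Averages and admissible perturbations.

module OptimalFunctions {c ℓ₁ ℓ₂} (ℝ : RealField c ℓ₁ ℓ₂) (expLn : ExpLn ℝ)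
  (G : FiniteConnectedGraph) where
  open RealField ℝ
  open ExpLn expLn
  open FiniteConnectedGraph G
  open LogMoments ℝ expLn G
  open Order ℝ
  open Exponential ℝ expLn
  open FiniteSums ℝ
  open Integers ℝ
  open Distances G

  order*𝔼 : ∀ X → fromℕ order * 𝔼 X ≈ sum X
  order*𝔼 X = trans (solve 3 (λ n i s → n :* (i :* s) := (i :* n) :* s) refl (fromℕ order)
    (1/ order) (sum X))
    (trans (*-congʳ (1/-inverseˡ order)) (*-identityˡ _))

  𝔼-mono-≤ : ∀ {X Y : RandomVariable} → (∀ v → X v ≤ Y v) → 𝔼 X ≤ 𝔼 Y
  𝔼-mono-≤ X≤Y = *-monoˡ-≤ (<⇒≤ (1/-pos order)) (sum-mono-≤ X≤Y)

  𝔼-+* : ∀ X s D → 𝔼 (λ v → X v + s * D v) ≈ 𝔼 X + s * 𝔼 D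
  𝔼-+* X s D = trans (*-congˡ (trans (∑-distrib-+ X (λ v → s * D v))
    (+-congˡ (sym (*-distribˡ-sum s D)))))
    (solve 4 (λ i a s b → i :* (a :+ s :* b) := i :* a :+ s :* (i :* b)) refl (1/ order)
      (sum X) s (sum D))

  𝔼-const : ∀ x → 𝔼 (λ _ → x) ≈ x
  𝔼-const x = trans (*-congˡ (sum-const order x))
    (trans (sym (*-assoc _ _ _)) (trans (*-congʳ (1/-inverseˡ order)) (*-identityˡ x)))

  -- The least of finitely many positive slacks serves for all; finding it means comparing reals,
  -- hence the double negation.
  ¬¬-common-slack : ∀ {p m} {P : Fin m → Carrier → Set p} →
    (∀ i {ε δ} → δ ≤ ε → P i ε → P i δ) →
    (∀ i → ¬ ¬ (∃[ ε ] 0# < ε × P i ε)) → ¬ ¬ (∃[ ε ] 0# < ε × (∀ i → P i ε))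
  ¬¬-common-slack {m = zero}  _  _    k = k (1# , 0<1 , λ ())
  ¬¬-common-slack {m = suc m} {P = P} shrink slack k =
    slack zero λ (ε , 0<ε , P₀) →
    ¬¬-common-slack (shrink ∘ suc) (slack ∘ suc) λ (δ , 0<δ , Pₛ) →
    ≤-⊎-> ε δ λ where
      (inj₁ ε≤δ) → k (ε , 0<ε , λ { zero → P₀ ; (suc i) → shrink (suc i) ε≤δ (Pₛ i) })
      (inj₂ δ<ε) → k (δ , 0<δ , λ { zero → shrink zero (<⇒≤ δ<ε) P₀ ; (suc i) → Pₛ i })

  -- Stays in the form `X v + s * D v`, so that `perturbation` and `first-order` apply without
  -- conversion.
  shift : ∀ {p} {C : Vertex → Set p} →
    (∀ v → Dec (C v)) → Carrier → RandomVariable → RandomVariable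
  shift C? s X v = X v + s * indicator (C? v)

  -- Differences within the class and within its complement do not change. Of the pairs that cross,
  -- `boundary` covers one orientation and symmetry of `dist` the other.
  shift-lipschitz : ∀ {p} {C : Vertex → Set p} (C? : ∀ v → Dec (C v)) s {X} → Lipschitz X →
    (∀ v w → C v → ¬ C w → ∣ (X v + s) - X w ∣≤ fromℕ (dist v w)) → Lipschitz (shift C? s X)
  shift-lipschitz C? s {X} lip boundary u v with C? u | C? v
  ... | yes _ | yes _ = ∣∣-resp
    (solve 3 (λ x y s → x :- y := (x :+ s :* con (+ 1)) :- (y :+ s :* con (+ 1)))
      refl (X u) (X v) s)
    refl (lip u v)
  ... | no _ | no _ = ∣∣-resp
    (solve 3 (λ x y s → x :- y := (x :+ s :* con (+ 0)) :- (y :+ s :* con (+ 0)))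
      refl (X u) (X v) s)
    refl (lip u v)
  ... | yes Cu | no ¬Cv = ∣∣-resp
    (solve 3 (λ x y s → (x :+ s) :- y := (x :+ s :* con (+ 1)) :- (y :+ s :* con (+ 0)))
      refl (X u) (X v) s)
    refl (boundary u v Cu ¬Cv)
  ... | no ¬Cu | yes Cv = ∣∣-resp
    (solve 3 (λ x y s → :- ((y :+ s) :- x) := (x :+ s :* con (+ 0)) :- (y :+ s :* con (+ 1)))
      refl (X u) (X v) s)
    (reflexive (≡.cong fromℕ (dist-sym v u))) (∣∣-neg (boundary v u Cv ¬Cu))

  -- Variational consequences of optimality.

  module _ {t : Carrier} (0<t : 0# < t) {X : RandomVariable} (X-optimal : Optimal t X) where

    private
      X-lipschitz : Lipschitz X
      X-lipschitz = proj₁ X-optimal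

    exponent weight : RandomVariable
    exponent v = t * (X v - 𝔼 X)
    weight v = exp (exponent v)

    direction : RandomVariable → RandomVariable
    direction D v = t * (D v - 𝔼 D)

    -- `exp` is monotone and undoes `ln`, so comparing log-moments compares moments; the common
    -- factor `1/ order` cancels.
    moment-maximal : ∀ Y → Lipschitz Y → sum (λ v → exp (t * (Y v - 𝔼 Y))) ≤ sum weight
    moment-maximal Y Y-lipschitz = *-cancelˡ-≤ (1/-pos order)
      (≤-resp (exp-ln _ _) (exp-ln _ _) (exp-mono-≤ (proj₂ (proj₂ X-optimal) Y Y-lipschitz)))

    -- Centring is linear, so each weight is multiplied by `exp (s * direction D v)`.
    perturbation : ∀ s D → Lipschitz (λ v → X v + s * D v) →
      sum (λ v → weight v * exp (s * direction D v)) ≤ sum weight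
    perturbation s D Y-lipschitz = ≤-resp
      (sum-cong λ v → trans (exp-cong (expand v)) (exp-+ _ _)) refl
      (moment-maximal (λ v → X v + s * D v) Y-lipschitz)
      where
      expand : ∀ v → t * ((X v + s * D v) - 𝔼 (λ v → X v + s * D v)) ≈
        exponent v + s * direction D v
      expand v = trans (*-congˡ (+-congˡ (-‿cong (𝔼-+* X s D))))
        (solve 6 (λ t x s d e f → t :* ((x :+ s :* d) :- (e :+ s :* f)) := t :* (x :- e) :+ s :*
          (t :* (d :- f)))
          refl t (X v) s (D v) (𝔼 X) (𝔼 D))

    weight-nonneg : ∀ v → 0# ≤ weight v
    weight-nonneg v = <⇒≤ (exp-pos (exponent v))

    -- Bounding each exponential below by its tangent line makes this exact at finite `s`. The
    -- factor `s` is kept because its sign is not fixed.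
    first-order : ∀ s D → Lipschitz (λ v → X v + s * D v) →
      s * sum (λ v → weight v * direction D v) ≤ 0#
    first-order s D Y-lipschitz = ≤-by
      (≤⇒0≤ (≤-trans (sum-mono-≤ λ v → *-monoˡ-≤ (weight-nonneg v)
        (1+x≤exp (s * direction D v)))
        (perturbation s D Y-lipschitz)))
      (trans (+-congˡ (-‿cong (trans
          (sum-cong λ v → solve 3 (λ w s d → w :* (con (+ 1) :+ s :* d) := w :+ s :* (w :* d))
            refl (weight v) s (direction D v))
          (trans (∑-distrib-+ weight (λ v → s * (weight v * direction D v)))
            (+-congˡ (sym (*-distribˡ-sum s (λ v → weight v * direction D v))))))))
        (solve 2 (λ w x → w :- (w :+ x) := con (+ 0) :- x) refl (sum weight) _))

    -- Jensen's inequality for `exp`, through the tangent line at 0: the linear terms average to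
    -- zero.
    1≤𝔼-weight : 1# ≤ 𝔼 weight
    1≤𝔼-weight = ≤-resp
      (trans (𝔼-+* (λ _ → 1#) t (λ v → X v - 𝔼 X))
        (trans (+-cong (𝔼-const 1#) (*-congˡ centred))
          (trans (+-congˡ (zeroʳ t)) (+-identityʳ 1#))))
      refl (𝔼-mono-≤ λ v → 1+x≤exp (exponent v))
      where
      centred : 𝔼 (λ v → X v - 𝔼 X) ≈ 0#
      centred = trans (*-congˡ (∑-distrib-+ X (λ _ → - 𝔼 X)))
        (trans (distribˡ _ _ _) (trans (+-congˡ (𝔼-const (- 𝔼 X))) (-‿inverseʳ (𝔼 X))))

    -- If no v had X v - X u = d (u , v), then X could be lowered at u, which
    -- increases the moment because weight u < 1 ≤ 𝔼 weight.
    ¬¬-tight-above : ∀ {u} → X u < 𝔼 X → ¬ ¬ (∃[ v ] u ≢ v × X v - X u ≈ fromℕ (dist u v))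
    ¬¬-tight-above {u} Xu<𝔼X ¬tight = ¬¬-common-slack shrink slack λ (ε , 0<ε , P) →
      let lowered : Lipschitz (shift (u Fin.≟_) (- ε) X)
          lowered = shift-lipschitz (u Fin.≟_) (- ε) X-lipschitz λ where
            -- Lowering `X` at `u` relaxes one of the two bounds; the other spends the slack.
            v w ≡.refl u≢w →
              ≤-trans (≤-by (<⇒≤ 0<ε) (solve 3 (λ x y ε → ε := (x :- y) :- ((x :+ :- ε) :- y))
                refl (X v) (X w) ε))
                      (proj₁ (X-lipschitz v w)) ,
              ≤-resp (solve 3 (λ x y ε → (y :- x) :+ ε := :- ((x :+ :- ε) :- y)) refl (X v)
                (X w) ε) refl (P w u≢w)
      in decrease-bad ε 0<ε (first-order (- ε) δᵤ lowered)
      where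
      P : Vertex → Carrier → Set ℓ₂
      P w ε = u ≢ w → (X w - X u) + ε ≤ fromℕ (dist u w)
      shrink : ∀ w {ε δ} → δ ≤ ε → P w ε → P w δ
      shrink w δ≤ε Pε u≢w = ≤-trans (+-mono-≤ ≤-refl δ≤ε) (Pε u≢w)
      slack : ∀ w → ¬ ¬ (∃[ ε ] 0# < ε × P w ε)
      slack w k = <-⊎-≈ (≤-resp (solve 2 (λ x y → :- (x :- y) := y :- x) refl (X u) (X w)) refl
        (proj₂ (X-lipschitz u w))) λ where
        (inj₁ X<d) → k (_ , <⇒0< X<d , λ _ → ≈⇒≤
          (solve 2 (λ a d → a :+ (d :- a) := d) refl (X w - X u) (fromℕ (dist u w))))
        -- Tightness at `w` is excluded unless `w` is `u`, where `P` is vacuous, so `1#` is an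
        -- arbitrary positive value.
        (inj₂ X≈d) → k (1# , 0<1 , λ u≢w → contradiction (w , u≢w , X≈d) ¬tight)
      δᵤ : RandomVariable
      δᵤ v = indicator (u Fin.≟ v)
      𝔼δᵤ : 𝔼 δᵤ ≈ 1/ order
      𝔼δᵤ = trans (*-congˡ (trans (sum-cong λ v → sym (*-identityˡ (δᵤ v)))
        (sum-at (λ _ → 1#) u))) (*-identityʳ _)
      derivative : sum (λ v → weight v * direction δᵤ v) ≈ t * (weight u - 𝔼 weight)
      derivative = begin
        sum (λ v → weight v * direction δᵤ v)
          ≈⟨ sum-cong (λ v → trans (*-congˡ (*-congˡ (+-congˡ (-‿cong 𝔼δᵤ))))
               (solve 4 (λ w t d i → w :* (t :* (d :- i)) := t :* (w :* d) :+
                 (:- (t :* i)) :* w)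
                 refl (weight v) t (δᵤ v) (1/ order))) ⟩
        sum (λ v → t * (weight v * δᵤ v) + (- (t * 1/ order)) * weight v)
          ≈⟨ ∑-distrib-+ (λ v → t * (weight v * δᵤ v)) (λ v → (- (t * 1/ order)) * weight v) ⟩
        sum (λ v → t * (weight v * δᵤ v)) + sum (λ v → (- (t * 1/ order)) * weight v)
          ≈⟨ +-cong (*-distribˡ-sum t (λ v → weight v * δᵤ v)) (*-distribˡ-sum _ weight) ⟨
        t * sum (λ v → weight v * δᵤ v) + (- (t * 1/ order)) * sum weight
          ≈⟨ +-congʳ (*-congˡ (sum-at weight u)) ⟩
        t * weight u + (- (t * 1/ order)) * sum weight
          ≈⟨ solve 4 (λ t w i s → t :* w :+ (:- (t :* i)) :* s := t :* (w :- i :* s)) refl t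
            (weight u) (1/ order) (sum weight) ⟩
        t * (weight u - 𝔼 weight) ∎
        where open ≈-Reasoning Ring.setoid
      decrease-bad : ∀ ε → 0# < ε → - ε * sum (λ v → weight v * direction δᵤ v) ≤ 0# → ⊥
      decrease-bad ε 0<ε decrease =
        1≤exp⇒0≤ (≤-trans 1≤𝔼-weight 𝔼≤weight)
          (<-by (*-pos 0<t (<⇒0< Xu<𝔼X)) (solve 3
            (λ t x e → t :* (e :- x) := con (+ 0) :- t :* (x :- e)) refl t (X u) (𝔼 X)))
        where
        𝔼≤weight : 𝔼 weight ≤ weight u
        𝔼≤weight = *-cancelˡ-≤ (*-pos 0<ε 0<t) (≤-by (≤⇒0≤ decrease)
          (trans (+-congˡ (-‿cong (*-congˡ derivative)))
            (solve 4 (λ ε t w e → con (+ 0) :- (:- ε) :* (t :* (w :- e)) := (ε :* t) :* w :-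
              (ε :* t) :* e)
              refl ε t (weight u) (𝔼 weight))))

    -- Shifting X by ± ε on the class C of u modulo ℤ keeps it Lipschitz, and by
    -- strict convexity one of the two shifts increases the moment unless the
    -- shift is constant.
    ¬¬-integral-differences : ∀ u v → ¬ ¬ IsInteger (X v - X u)
    ¬¬-integral-differences u v ¬Cv =
      ¬¬-Fin (λ w → ¬¬-excluded-middle) λ C? →
      ¬¬-common-slack (λ x δ≤ε Px y → shrink x y δ≤ε (Px y))
        (λ x → ¬¬-common-slack (shrink x) (slack C? x)) λ (ε , 0<ε , Pε) →
      shifts-lipschitz⇒⊥ C? ε 0<ε
        (shift-lipschitz C? ε X-lipschitz λ x y Cx ¬Cy → ∣∣-resp
          (solve 3 (λ x y ε → (x :- y) :+ ε := (x :+ ε) :- y) refl (X x) (X y) ε)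
          (solve 2 (λ d ε → (d :- ε) :+ ε := d) refl _ ε)
          (∣∣-+ (Pε x y Cx ¬Cy) (nonneg⇒∣∣ (<⇒≤ 0<ε))))
        (shift-lipschitz C? (- ε) X-lipschitz λ x y Cx ¬Cy → ∣∣-resp
          (solve 3 (λ x y ε → (x :- y) :+ :- ε := (x :+ :- ε) :- y) refl (X x) (X y) ε)
          (solve 2 (λ d ε → (d :- ε) :+ ε := d) refl _ ε)
          (∣∣-+ (Pε x y Cx ¬Cy) (∣∣-neg (nonneg⇒∣∣ (<⇒≤ 0<ε)))))
      where
      C : Vertex → Set ℓ₁
      C w = IsInteger (X w - X u)

      P : Vertex → Vertex → Carrier → Set (ℓ₁ ⊔ ℓ₂)
      P x y ε = C x → ¬ C y → ∣ X x - X y ∣≤ fromℕ (dist x y) - ε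

      shrink : ∀ x y {ε δ} → δ ≤ ε → P x y ε → P x y δ
      shrink x y {ε} {δ} δ≤ε Pε Cx ¬Cy = ∣∣-≤ (Pε Cx ¬Cy) (+-mono-≤ ≤-refl
        (≤-by (≤⇒0≤ δ≤ε) (solve 2 (λ δ ε → ε :- δ := :- δ :- :- ε) refl δ ε)))

      slack : (∀ w → Dec (C w)) → ∀ x y → ¬ ¬ (∃[ ε ] 0# < ε × P x y ε)
      slack C? x y k = case (C? x) (C? y)
        where
        d = fromℕ (dist x y)
        D = X x - X y
        -- No pair across the boundary is tight: a tight difference is plus or minus a distance,
        -- hence an integer, and would put `y` in the class of `x`.
        int-y : C x → IsInteger D → C y
        int-y Cx int-D = isInteger-≈
          (solve 3 (λ x y u → (x :- u) :+ :- (x :- y) := y :- u) refl (X x) (X y) (X u))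
          (isInteger-+ Cx (isInteger-neg int-D))
        case : Dec (C x) → Dec (C y) → ⊥
        case (no ¬Cx) _        = k (1# , 0<1 , λ Cx → contradiction Cx ¬Cx)
        case (yes _)  (yes Cy) = k (1# , 0<1 , λ _ ¬Cy → contradiction Cy ¬Cy)
        case (yes Cx) (no ¬Cy) =
          <-⊎-≈ (proj₁ (X-lipschitz x y)) λ where
            (inj₂ D≈d) → ¬Cy (int-y Cx (isInteger-≈ (sym D≈d) (isInteger-fromℕ (dist x y))))
            (inj₁ D<d) → <-⊎-≈ (proj₂ (X-lipschitz x y)) λ where
              (inj₂ -D≈d) → ¬Cy (int-y Cx
                (isInteger-≈ (trans (-‿cong (sym -D≈d)) (-‿involutive D))
                              (isInteger-neg (isInteger-fromℕ (dist x y)))))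
              -- The smaller of the two one-sided slacks serves both bounds.
              (inj₁ -D<d) → ≤-⊎-> (d - D) (d - - D) λ where
                (inj₁ ≤) → k (d - D , <⇒0< D<d , λ _ _ →
                  ≈⇒≤ (solve 2 (λ d D → D := d :- (d :- D)) refl d D) ,
                  ≤-by (≤⇒0≤ ≤) (solve 2 (λ d D → (d :- :- D) :- (d :- D) :=
                    (d :- (d :- D)) :- :- D) refl d D))
                (inj₂ >) → k (d - - D , <⇒0< -D<d , λ _ _ →
                  ≤-by (≤⇒0≤ (<⇒≤ >)) (solve 2 (λ d D → (d :- D) :- (d :- :- D) :=
                    (d :- (d :- :- D)) :- D) refl d D) ,
                  ≈⇒≤ (solve 2 (λ d D → :- D := d :- (d :- :- D)) refl d D))

      shifts-lipschitz⇒⊥ : (C? : ∀ w → Dec (C w)) → ∀ ε → 0# < ε →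
        Lipschitz (shift C? ε X) → Lipschitz (shift C? (- ε) X) → ⊥
      shifts-lipschitz⇒⊥ C? ε 0<ε up down =
        -- `u` is in the class through the integer 0 and `v` is outside it, so an indicator
        -- everywhere equal to its mean gives 1 = 0.
        ≈⇒≤ (trans (sym (indicator-yes (C? u) (+ 0 , -‿inverseʳ (X u))))
              (trans (D≈𝔼D u) (trans (sym (D≈𝔼D v)) (indicator-no (C? v) ¬Cv)))) 0<1
        where
        D h h⁻ : RandomVariable
        D w = indicator (C? w)
        h w = ε * direction D w
        h⁻ w = - ε * direction D w

        -- Add the tangent-line bounds at `h w` and `h⁻ w`; the linear terms cancel. Optimality
        -- reverses the inequality of the sums, which forces equality at every `w`.
        convexity : ∀ w → weight w + weight w ≤ weight w * exp (h w) + weight w * exp (h⁻ w)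
        convexity w = ≤-by
          (*-nonneg (weight-nonneg w) (+-nonneg (≤⇒0≤ (1+x≤exp (h w))) (≤⇒0≤ (1+x≤exp (h⁻ w)))))
          (solve 5 (λ a e f ε d →
              a :* ((e :- (con (+ 1) :+ ε :* d)) :+ (f :- (con (+ 1) :+ (:- ε) :* d)))
              := (a :* e :+ a :* f) :- (a :+ a))
            refl (weight w) (exp (h w)) (exp (h⁻ w)) ε (direction D w))

        optimality : sum (λ w → weight w * exp (h w) + weight w * exp (h⁻ w)) ≤
          sum (λ w → weight w + weight w)
        optimality = ≤-resp
          (sym (∑-distrib-+ (λ w → weight w * exp (h w)) (λ w → weight w * exp (h⁻ w))))
          (sym (∑-distrib-+ weight weight))
          (+-mono-≤ (perturbation ε D up) (perturbation (- ε) D down))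

        h≈0 : ∀ w → h w ≈ 0#
        h≈0 w = exp+exp⁻≤2⇒≈0 (*-cancelˡ-≤ (exp-pos (exponent w)) (≤-resp
          (trans (+-congˡ (*-congˡ (exp-cong
            (solve 2 (λ ε d → (:- ε) :* d := :- (ε :* d)) refl ε (direction D w)))))
            (sym (distribˡ _ _ _)))
          (solve 1 (λ a → a :+ a := a :* con (+ 2)) refl (weight w))
          (sum-mono-≤-tight convexity optimality w)))

        D≈𝔼D : ∀ w → D w ≈ 𝔼 D
        D≈𝔼D w = *-cancelˡ-≈ (*-pos 0<ε 0<t) (trans
          (solve 4 (λ ε t d m → (ε :* t) :* d := ε :* (t :* (d :- m)) :+ (ε :* t) :* m) refl ε t
            (D w) (𝔼 D))
          (trans (+-congʳ (h≈0 w)) (+-identityˡ _)))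

    -- The Lipschitz bound confines the difference to finitely many integers, so the double negation
    -- can be removed and the integer itself obtained.
    integral-differences : ∀ u v → IsInteger (X v - X u)
    integral-differences u v = isInteger-stable (dist v u) (X-lipschitz v u)
      (¬¬-integral-differences u v)

    -- Deciding membership in `𝕆 X`.

    -- This is `order` times the centred value, written as a sum of differences so that it is
    -- visibly an integer.
    deviation : RandomVariable
    deviation v = sum (λ w → X v - X w)

    deviation-isInteger : ∀ v → IsInteger (deviation v)
    deviation-isInteger v = isInteger-sum (λ w → integral-differences w v)

    deviation≈ : ∀ v → deviation v ≈ fromℕ order * (X v - 𝔼 X)
    deviation≈ v = begin
      sum (λ w → X v - X w)                     ≈⟨ ∑-distrib-+ (λ _ → X v) (λ w → - X w) ⟩
      sum {order} (λ _ → X v) + sum (λ w → - X w)       ≈⟨ +-cong (sum-const order (X v))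
        (sum-cong λ w → sym (-1*x≈-x (X w))) ⟩
      fromℕ order * X v + sum (λ w → - 1# * X w) ≈⟨ +-congˡ (*-distribˡ-sum (- 1#) X) ⟨
      fromℕ order * X v + - 1# * sum X          ≈⟨ +-congˡ (*-congˡ (order*𝔼 X)) ⟨
      fromℕ order * X v + - 1# * (fromℕ order * 𝔼 X)
        ≈⟨ solve 3 (λ n x e → n :* x :+ (:- con (+ 1)) :* (n :* e) := n :* (x :- e)) refl
          (fromℕ order) (X v) (𝔼 X) ⟩
      fromℕ order * (X v - 𝔼 X)                 ∎
      where open ≈-Reasoning Ring.setoid

    private
      1/2*2≈1 : 1/ 2 * (1# + 1#) ≈ 1#
      1/2*2≈1 = trans (*-congˡ (solve 0 (con (+ 2) := con (+ 1) :+ (con (+ 1) :+ con (+ 0)))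
        refl)) (1/-inverseˡ 2)

    -- The factor `order` clears the denominator of the mean and `1# + 1#` that of `1/ 2`; the sign
    -- of the resulting integer is decidable.
    scaled-pos? : ∀ {x} → IsInteger (fromℕ order * ((1# + 1#) * x)) → Dec (0# < x)
    scaled-pos? {x} int = map′ unscale
      (λ 0<x → *-pos (fromℕ-pos (ℕ.>-nonZero⁻¹ order)) (*-pos 0<2 0<x)) (0<? int)
      where
      unscale : 0# < fromℕ order * ((1# + 1#) * x) → 0# < x
      unscale 0<nx = <.<-respʳ-≈
        (trans (solve 4 (λ a b n x → a :* (b :* (n :* (con (+ 2) :* x))) := (a :* con (+ 2)) :*
          ((b :* n) :* x)) refl
                  (1/ 2) (1/ order) (fromℕ order) x)
          (trans (*-cong 1/2*2≈1 (*-congʳ (1/-inverseˡ order)))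
            (trans (*-identityˡ _) (*-identityˡ _))))
        (*-pos (1/-pos 2) (*-pos (1/-pos order) 0<nx))

    -- The two ends of the window become the signs of the integers 2 `deviation v` ± `order`.
    𝕆? : ∀ v → Dec (𝕆 X v)
    𝕆? v = map′ (λ { (0<y+½ , ¬0<y-½) → <-by 0<y+½ lower , λ ½<y → ¬0<y-½ (<⇒0< ½<y) })
                (λ { (-½<y , y≤½) → <.<-respʳ-≈ (sym lower) (<⇒0< -½<y) ,
                       λ 0<y-½ → y≤½ (<-by 0<y-½ refl) })
      (scaled-pos? (isInteger-≈ scaled⁺ (isInteger-+ 2dev order-int))
       ×-dec ¬? (scaled-pos? (isInteger-≈ scaled⁻
         (isInteger-+ 2dev (isInteger-neg order-int)))))
      where
      n = fromℕ order
      y = X v - 𝔼 X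
      order-int = isInteger-fromℕ order
      2dev : IsInteger (n * y + n * y)
      2dev = isInteger-≈ (+-cong (deviation≈ v) (deviation≈ v))
        (isInteger-+ (deviation-isInteger v) (deviation-isInteger v))
      lower : y + 1/ 2 ≈ y - - 1/ 2
      lower = solve 2 (λ y i → y :+ i := y :- :- i) refl y (1/ 2)
      n≈ : n ≈ n * (1/ 2 * (1# + 1#))
      n≈ = trans (sym (*-identityʳ n)) (*-congˡ (sym 1/2*2≈1))
      scaled⁺ : (n * y + n * y) + n ≈ n * ((1# + 1#) * (y + 1/ 2))
      scaled⁺ = trans (+-congˡ n≈) (solve 3 (λ n y i →
        (n :* y :+ n :* y) :+ n :* (i :* con (+ 2)) := n :* (con (+ 2) :* (y :+ i))) refl n y
          (1/ 2))
      scaled⁻ : (n * y + n * y) - n ≈ n * ((1# + 1#) * (y - 1/ 2))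
      scaled⁻ = trans (+-congˡ (-‿cong n≈)) (solve 3 (λ n y i →
        (n :* y :+ n :* y) :- n :* (i :* con (+ 2)) := n :* (con (+ 2) :* (y :- i))) refl n y
          (1/ 2))

    -- The ascent from `u` to `𝕆 X`.

    -- Integrality makes the search over neighbours decidable, so a tight vertex known only under
    -- double negation still yields an actual neighbour.
    ascend : ∀ {u} → X u < 𝔼 X → ∃[ w ] u ~ w × X w - X u ≈ 1#
    ascend {u} Xu<𝔼X = decidable-stable
      (Fin.any? λ w → (u ~? w) ×-dec ≈1? w)
      λ ¬ascent → ¬¬-tight-above Xu<𝔼X λ (v , u≢v , tight) → ¬ascent (first-step v u≢v tight)
      where
      ≈1? : ∀ w → Dec (X w - X u ≈ 1#)
      ≈1? w = map′
        (λ x-1≈0 → trans (solve 1 (λ x → x := (x :- con (+ 1)) :+ con (+ 1)) refl _)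
          (trans (+-congʳ x-1≈0) (+-identityˡ 1#)))
        (λ x≈1 → trans (+-congʳ x≈1) (-‿inverseʳ 1#))
        (≈0? (isInteger-+ (integral-differences u w) (isInteger-neg (+ 1 , refl))))
      first-step : ∀ v → u ≢ v → X v - X u ≈ fromℕ (dist u v) → ∃[ w ] u ~ w × X w - X u ≈ 1#
      first-step v u≢v tight =
        let w , u~w , 1+d≤ = geodesic-head u≢v
            upper : X w - X u ≤ 1#
            upper = ≤-trans (proj₁ (∣∣-resp (solve 2 (λ a b → :- (a :- b) := b :- a) refl (X u)
              (X w)) refl (∣∣-neg (X-lipschitz u w))))
              (≤-resp refl (+-identityʳ 1#) (fromℕ-mono-≤ (dist-≤ (u~w ∷ []))))
            -- The rise from `u` to `v` is at least 1 + d (w , v), and the part after `w`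
            -- contributes at most d (w , v).
            lower : 1# ≤ X w - X u
            lower = ≤-by (+-nonneg (≤⇒0≤ (≤-resp refl (sym tight) (fromℕ-mono-≤ 1+d≤)))
                (≤⇒0≤ (proj₂ (X-lipschitz w v))))
              (solve 4 (λ u v w d → ((v :- u) :- (con (+ 1) :+ d)) :+ (d :- :- (w :- v)) :=
                (w :- u) :- con (+ 1))
                refl (X u) (X v) (X w) (fromℕ (dist w v)))
        in w , u~w , ≤-antisym upper lower

    -- Each step of the ascent raises X by exactly 1, the length of the half-open
    -- window defining 𝕆 X, so the ascent cannot jump over 𝕆 X.
    climb : ∀ n {u} → 𝔼 X ≤ X u + fromℕ n → X u - 𝔼 X ≤ 1/ 2 →
            ∃[ w ] ∃[ k ] 𝕆 X w × Walk _~_ u w k × X w - X u ≈ fromℕ k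
    climb n {u} 𝔼≤ y≤½ = step n 𝔼≤ (𝕆? u)
      where
      y≤-½⇒X<𝔼 : X u - 𝔼 X ≤ - 1/ 2 → X u < 𝔼 X
      y≤-½⇒X<𝔼 y≤-½ = <-by (<-≤-trans (1/-pos 2) (≤-by (≤⇒0≤ y≤-½)
          (solve 2 (λ h y → :- h :- y := :- y :- h) refl (1/ 2) (X u - 𝔼 X))))
        (solve 2 (λ x e → :- (x :- e) := e :- x) refl (X u) (𝔼 X))
      step : ∀ n → 𝔼 X ≤ X u + fromℕ n → Dec (𝕆 X u) →
             ∃[ w ] ∃[ k ] 𝕆 X w × Walk _~_ u w k × X w - X u ≈ fromℕ k
      step n       𝔼≤ (yes u∈𝕆) = u , 0 , u∈𝕆 , [] , -‿inverseʳ (X u)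
      -- The counter bounds the rise still missing up to the mean. At zero, `X u` has reached the
      -- mean, so it cannot lie below the window, and `y≤½` keeps it from lying above.
      step zero    𝔼≤ (no u∉𝕆)  = contradiction
        (y≤-½⇒X<𝔼 λ -½<y → u∉𝕆 (-½<y , y≤½)) (≤-resp refl (+-identityʳ _) 𝔼≤)
      step (suc n) 𝔼≤ (no u∉𝕆)  =
        let y≤-½ = λ -½<y → u∉𝕆 (-½<y , y≤½)
            v , u~v , Xv-Xu≈1 = ascend (y≤-½⇒X<𝔼 y≤-½)
            w , k , w∈𝕆 , p , Xw-Xv≈k = climb n {v}
              (≤-by (≤⇒0≤ 𝔼≤) (trans (solve 3 (λ x n e → (x :+ (con (+ 1) :+ n)) :- e :=
                ((con (+ 1) :+ x) :+ n) :- e) refl (X u) (fromℕ n) (𝔼 X))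
                (+-congʳ (+-congʳ (trans (+-congʳ (sym Xv-Xu≈1))
                  (solve 2 (λ a b → (a :- b) :+ b := a) refl (X v) (X u)))))))
              (≤-by (≤⇒0≤ y≤-½) (trans
                (solve 3 (λ h x e → :- h :- (x :- e) := h :- ((h :* con (+ 2) :+ x) :- e)) refl
                  (1/ 2) (X u) (𝔼 X))
                (+-congˡ (-‿cong (+-congʳ (trans (+-congʳ (trans 1/2*2≈1 (sym Xv-Xu≈1)))
                  (solve 2 (λ a b → (a :- b) :+ b := a) refl (X v) (X u))))))))
        in w , suc k , w∈𝕆 , u~v ∷ p ,
           trans (solve 3 (λ a b c → a :- c := (b :- c) :+ (a :- b)) refl (X w) (X v) (X u))
             (+-cong Xv-Xu≈1 Xw-Xv≈k)

    -- The window is half-open of length 1, so two of its values differ by an integer strictly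
    -- between -1 and 1. Hence ν does not depend on the vertex at which it is read.
    𝕆-constant : ∀ {v w} → 𝕆 X v → 𝕆 X w → X v ≈ X w
    𝕆-constant {v} {w} v∈𝕆 w∈𝕆 = trans (solve 2 (λ a b → a := (a :- b) :+ b) refl (X v) (X w))
      (trans (+-congʳ (∣integer∣<1⇒≈0 (integral-differences w v) (apart v∈𝕆 w∈𝕆)
          (<.<-respˡ-≈ (solve 2 (λ a b → b :- a := :- (a :- b)) refl (X v) (X w))
            (apart w∈𝕆 v∈𝕆))))
        (+-identityˡ _))
      where
      apart : ∀ {v w} → 𝕆 X v → 𝕆 X w → X v - X w < 1#
      apart {v} {w} (_ , y≤½) (-½<z , _) = ≤-<-trans
        (≤-by (≤⇒0≤ y≤½) (solve 4 (λ h a b e → h :- (a :- e) := ((h :+ e) :- b) :- (a :- b))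
          refl (1/ 2) (X v) (X w) (𝔼 X)))
        (<-by (<⇒0< -½<z) (trans
          (solve 3 (λ h b e → (b :- e) :- :- h := h :* con (+ 2) :- ((h :+ e) :- b)) refl (1/ 2)
            (X w) (𝔼 X))
          (+-congʳ 1/2*2≈1)))

    -- The climb supplies a walk of length `k` into `𝕆 X` along which `X` rises by `k`. The rise to
    -- every other vertex of `𝕆 X` is the same, so the Lipschitz condition makes `k` a lower bound
    -- for all these distances.
    ν-distance : ∀ {u} → X u < 𝔼 X →
      ∃[ k ] (dist[ u , 𝕆 X ]≡ k) × (∀ ν → Isν X ν → ν - (X u - 𝔼 X) ≈ fromℕ k)
    ν-distance {u} Xu<𝔼X =
      let n , ∣Xu-𝔼∣≤n = bounded (X u - 𝔼 X)
          w , k , w∈𝕆 , p , Xw-Xu≈k = climb n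
            (≤-by (≤⇒0≤ (proj₂ ∣Xu-𝔼∣≤n)) (solve 3 (λ n x e → n :- :- (x :- e) := (x :+ n) :- e)
              refl (fromℕ n) (X u) (𝔼 X)))
            (<⇒≤ (<.trans (<-by (<⇒0< Xu<𝔼X) (solve 2 (λ x e → e :- x := con (+ 0) :- (x :- e))
              refl (X u) (𝔼 X))) (1/-pos 2)))
          rise : ∀ v → 𝕆 X v → X v - X u ≈ fromℕ k
          rise v v∈𝕆 = trans (+-congʳ (𝕆-constant v∈𝕆 w∈𝕆)) Xw-Xu≈k
          k≤dist : ∀ v → 𝕆 X v → k ℕ.≤ dist u v
          k≤dist v v∈𝕆 = fromℕ-cancel-≤ (≤-resp
            (trans (solve 2 (λ a b → :- (b :- a) := a :- b) refl (X v) (X u)) (rise v v∈𝕆)) refl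
              (proj₂ (X-lipschitz u v)))
      in k , ((w , w∈𝕆 , ℕ.≤-antisym (dist-≤ p) (k≤dist w w∈𝕆)) , k≤dist) ,
         λ ν (v , v∈𝕆 , ν≈) → trans (+-congʳ ν≈)
           (trans (solve 3 (λ v u e → (v :- e) :- (u :- e) := v :- u) refl (X v) (X u) (𝔼 X))
             (rise v v∈𝕆))

-- The distance formula, in general and for mean zero.

corollary2p15 : ∀ {c ℓ₁ ℓ₂} (ℝ : RealField c ℓ₁ ℓ₂) (expLn : ExpLn ℝ) (G : FiniteConnectedGraph) →
    let open RealField ℝ
        open FiniteConnectedGraph G
        open LogMoments ℝ expLn G
    in
    ∀ (t : Carrier) → 0# < t →
    ∀ (X : RandomVariable) → Optimal t X →
    ∀ (u : Vertex) →
      (X u < 𝔼 X →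
        ∃[ k ] (dist[ u , 𝕆 X ]≡ k)
             × (∀ ν → Isν X ν → ν - (X u - 𝔼 X) ≈ fromℕ k))
    × (𝔼 X ≈ 0# → X u < 0# →
        ∃[ k ] (dist[ u , 𝕆 X ]≡ k)
             × (∀ ν → Isν X ν → ν - X u ≈ fromℕ k))
corollary2p15 ℝ expLn G t 0<t X X-optimal u =
  ν-distance 0<t X-optimal ,
  λ 𝔼X≈0 Xu<0 →
    let k , dist≡k , ν-k = ν-distance 0<t X-optimal (<.<-respʳ-≈ (sym 𝔼X≈0) Xu<0)
    in k , dist≡k , λ ν isν → trans
         (trans (solve 2 (λ n x → n :- x := n :- (x :- con (+ 0))) refl ν (X u))
                (+-congˡ (-‿cong (+-congˡ (-‿cong (sym 𝔼X≈0))))))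
         (ν-k ν isν)
  where
  open RealField ℝ
  open Order ℝ
  open OptimalFunctions ℝ expLn G
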